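{- Let $q=p^h$ with $p$ prime and $h>1$, and let $n\geq 2$. Let $v\in\mathbb{F}_p^{\theta_n}$ be the incidence vector of a small linear blocking set of $PG(n,q)$ that is not a hyperplane. Then $v\notin C(PG(n,q))$.
   Context: $C(PG(n,q))$ is the $\mathbb{F}_p$-span of the incidence vectors of the hyperplanes of $PG(n,q)$, with coordinates indexed by the $\theta_n=(q^{n+1}-1)/(q-1)$ points. Field reduction: points of $PG(n,q)$ correspond to the elements of the Desarguesian $(h-1)$-spread $\mathcal{D}$ of $PG(h(n+1)-1,p)$, obtained by viewing each $1$-dimensional $\mathbb{F}_q$-subspace of $\mathbb{F}_q^{n+1}$ as an $h$-dimensional $\mathbb{F}_p$-subspace of $\mathbb{F}_p^{h(n+1)}$. For a subspace $U$ of $PG(h(n+1)-1,p)$, $\mathcal{B}(U)$ is the set of spread elements meeting $U$, viewed as a point set of $PG(n,q)$. A small linear blocking set is $\mathcal{B}(U)$ with $\dim U=h(n-1)$. -}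

module Defs where

open import Algebra.Bundles using (Ring; CommutativeRing)
open import Algebra.Definitions using (Invertible)
open import Algebra.Definitions.RawMonoid using (sum)
open import Algebra.Module.Bundles using (LeftModule)
open import Algebra.Morphism.Structures using (IsRingHomomorphism)
open import Data.Fin.Base using (Fin)
open import Data.Nat.Base using (ℕ; suc) renaming (_*_ to _*ℕ_; _∸_ to _∸ℕ_)
open import Data.Product.Base using (∃; ∃-syntax; ∃₂; _×_; _,_)
open import Data.Vec.Functional using (Vector)
open import Function.Bundles using (Func; Inverse)
open import Level using (Level; 0ℓ; _⊔_) renaming (suc to lsuc)
open import Relation.Binary.Bundles using (Setoid)
open import Relation.Binary.Definitions using (_Respects_)
import Relation.Binary.Construct.On as On
import Relation.Binary.PropositionalEquality.Properties as ≡
open import Relation.Nullary.Negation.Core using (¬_)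
open import Relation.Unary using (Pred; _∈_; _∉_; _≐_)
open import Relation.Unary.Relation.Binary.Equality using (≐-setoid)

private
  variable
    c ℓ c′ ℓ′ m ℓm p : Level

record Field c ℓ : Set (lsuc (c ⊔ ℓ)) where
  field
    commutativeRing : CommutativeRing c ℓ
  open CommutativeRing commutativeRing public
  field
    1≉0     : 1# ≉ 0#
    inverse : ∀ {x} → x ≉ 0# → Invertible _≈_ 1# _*_ x

HasOrder : Field c ℓ → ℕ → Set (c ⊔ ℓ)
HasOrder F q = Inverse (Field.setoid F) (≡.setoid (Fin q))

module _ (R : Ring c ℓ) where
  open Ring R

  coordinateModule : ℕ → LeftModule R c ℓ
  coordinateModule k = record
    { Carrierᴹ = Vector Carrier k
    ; _≈ᴹ_ = λ u v → ∀ i → u i ≈ v i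
    ; _+ᴹ_ = λ u v i → u i + v i
    ; _*ₗ_ = λ a v i → a * v i
    ; 0ᴹ = λ _ → 0#
    ; -ᴹ_ = λ v i → - v i
    ; isLeftModule = record
      { isLeftSemimodule = record
        { +ᴹ-isCommutativeMonoid = record
          { isMonoid = record
            { isSemigroup = record
              { isMagma = record
                { isEquivalence = record
                  { refl = λ _ → refl
                  ; sym = λ e i → sym (e i)
                  ; trans = λ e f i → trans (e i) (f i)
                  }
                ; ∙-cong = λ e f i → +-cong (e i) (f i)
                }
              ; assoc = λ u v w i → +-assoc (u i) (v i) (w i)
              }
            ; identity = (λ v i → +-identityˡ (v i)) , (λ v i → +-identityʳ (v i))
            }
          ; comm = λ u v i → +-comm (u i) (v i)
          }
        ; isPreleftSemimodule = record
          { *ₗ-cong = λ e f i → *-cong e (f i)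
          ; *ₗ-zeroˡ = λ v i → zeroˡ (v i)
          ; *ₗ-distribʳ = λ v a b i → distribʳ (v i) a b
          ; *ₗ-identityˡ = λ v i → *-identityˡ (v i)
          ; *ₗ-assoc = λ a b v i → *-assoc a b (v i)
          ; *ₗ-zeroʳ = λ a _ → zeroʳ a
          ; *ₗ-distribˡ = λ a u v i → distribˡ a (u i) (v i)
          }
        }
      ; -ᴹ‿cong = λ e i → -‿cong (e i)
      ; -ᴹ‿inverse = (λ v i → -‿inverseˡ (v i)) , (λ v i → -‿inverseʳ (v i))
      }
    }

  functionModule : Setoid c′ ℓ′ → LeftModule R (c ⊔ ℓ ⊔ c′ ⊔ ℓ′) (ℓ ⊔ c′)
  functionModule X = record
    { Carrierᴹ = Func X setoid
    ; _≈ᴹ_ = λ f g → ∀ x → to f x ≈ to g x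
    ; _+ᴹ_ = λ f g → record
      { to = λ x → to f x + to g x
      ; cong = λ e → +-cong (cong f e) (cong g e) }
    ; _*ₗ_ = λ a f → record
      { to = λ x → a * to f x
      ; cong = λ e → *-congˡ (cong f e) }
    ; 0ᴹ = record { to = λ _ → 0# ; cong = λ _ → refl }
    ; -ᴹ_ = λ f → record
      { to = λ x → - to f x
      ; cong = λ e → -‿cong (cong f e) }
    ; isLeftModule = record
      { isLeftSemimodule = record
        { +ᴹ-isCommutativeMonoid = record
          { isMonoid = record
            { isSemigroup = record
              { isMagma = record
                { isEquivalence = record
                  { refl = λ _ → refl
                  ; sym = λ e x → sym (e x)
                  ; trans = λ e e′ x → trans (e x) (e′ x)
                  }
                ; ∙-cong = λ e e′ x → +-cong (e x) (e′ x)
                }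
              ; assoc = λ f g k x → +-assoc (to f x) (to g x) (to k x)
              }
            ; identity = (λ f x → +-identityˡ (to f x)) , (λ f x → +-identityʳ (to f x))
            }
          ; comm = λ f g x → +-comm (to f x) (to g x)
          }
        ; isPreleftSemimodule = record
          { *ₗ-cong = λ e e′ x → *-cong e (e′ x)
          ; *ₗ-zeroˡ = λ f x → zeroˡ (to f x)
          ; *ₗ-distribʳ = λ f a b x → distribʳ (to f x) a b
          ; *ₗ-identityˡ = λ f x → *-identityˡ (to f x)
          ; *ₗ-assoc = λ a b f x → *-assoc a b (to f x)
          ; *ₗ-zeroʳ = λ a _ → zeroʳ a
          ; *ₗ-distribˡ = λ a f g x → distribˡ a (to f x) (to g x)
          }
        }
      ; -ᴹ‿cong = λ e x → -‿cong (e x)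
      ; -ᴹ‿inverse = (λ f x → -‿inverseˡ (to f x)) , (λ f x → -‿inverseʳ (to f x))
      }
    }
    where open Func

restrictScalars : {R : Ring c ℓ} {S : Ring c′ ℓ′} {ι : Ring.Carrier R → Ring.Carrier S} →
                  IsRingHomomorphism (Ring.rawRing R) (Ring.rawRing S) ι →
                  LeftModule S m ℓm → LeftModule R m ℓm
restrictScalars {ι = ι} ι-hom M = record
  { Carrierᴹ = Carrierᴹ
  ; _≈ᴹ_ = _≈ᴹ_
  ; _+ᴹ_ = _+ᴹ_
  ; _*ₗ_ = λ a v → ι a *ₗ v
  ; 0ᴹ = 0ᴹ
  ; -ᴹ_ = -ᴹ_
  ; isLeftModule = record
    { isLeftSemimodule = record
      { +ᴹ-isCommutativeMonoid = +ᴹ-isCommutativeMonoid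
      ; isPreleftSemimodule = record
        { *ₗ-cong = λ e f → *ₗ-cong (⟦⟧-cong e) f
        ; *ₗ-zeroˡ = λ v → ≈ᴹ-trans (*ₗ-cong 0#-homo ≈ᴹ-refl) (*ₗ-zeroˡ v)
        ; *ₗ-distribʳ = λ v a b → ≈ᴹ-trans (*ₗ-cong (+-homo a b) ≈ᴹ-refl) (*ₗ-distribʳ v (ι a) (ι b))
        ; *ₗ-identityˡ = λ v → ≈ᴹ-trans (*ₗ-cong 1#-homo ≈ᴹ-refl) (*ₗ-identityˡ v)
        ; *ₗ-assoc = λ a b v → ≈ᴹ-trans (*ₗ-cong (*-homo a b) ≈ᴹ-refl) (*ₗ-assoc (ι a) (ι b) v)
        ; *ₗ-zeroʳ = λ a → *ₗ-zeroʳ (ι a)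
        ; *ₗ-distribˡ = λ a → *ₗ-distribˡ (ι a)
        }
      }
    ; -ᴹ‿cong = -ᴹ‿cong
    ; -ᴹ‿inverse = -ᴹ‿inverse
    }
  }
  where
  open LeftModule M
  open IsRingHomomorphism ι-hom

module LinearAlgebra {R : Ring c ℓ} (M : LeftModule R m ℓm) where
  open Ring R using (Carrier; _≈_; 0#)
  open LeftModule M

  linearCombination : ∀ {k} → Vector Carrier k → Vector Carrierᴹ k → Carrierᴹ
  linearCombination a b = sum +ᴹ-rawMonoid (λ i → a i *ₗ b i)

  Span : Pred Carrierᴹ p → Pred Carrierᴹ (c ⊔ m ⊔ ℓm ⊔ p)
  Span S v = ∃[ k ] ∃₂ λ (a : Vector Carrier k) (b : Vector Carrierᴹ k) →
             (∀ i → b i ∈ S) × v ≈ᴹ linearCombination a b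

  LinearlyIndependent : ∀ {k} → Vector Carrierᴹ k → Set (c ⊔ ℓ ⊔ ℓm)
  LinearlyIndependent b = ∀ a → linearCombination a b ≈ᴹ 0ᴹ → ∀ i → a i ≈ 0#

  record Subspace p : Set (c ⊔ m ⊔ ℓm ⊔ lsuc p) where
    field
      Member    : Pred Carrierᴹ p
      resp      : Member Respects _≈ᴹ_
      0-closed  : 0ᴹ ∈ Member
      +-closed  : ∀ {u v} → u ∈ Member → v ∈ Member → u +ᴹ v ∈ Member
      *ₗ-closed : ∀ a {v} → v ∈ Member → a *ₗ v ∈ Member

  open Subspace

  record IsBasis {k} (W : Subspace p) (b : Vector Carrierᴹ k) : Set (c ⊔ ℓ ⊔ m ⊔ ℓm ⊔ p) where
    field
      members     : ∀ i → b i ∈ Member W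
      independent : LinearlyIndependent b
      spanning    : ∀ {w} → w ∈ Member W → ∃[ a ] w ≈ᴹ linearCombination a b

  HasDimension : Subspace p → ℕ → Set (c ⊔ ℓ ⊔ m ⊔ ℓm ⊔ p)
  HasDimension W d = ∃ λ (b : Vector Carrierᴹ d) → IsBasis W b

  HasProjectiveDimension : Subspace p → ℕ → Set (c ⊔ ℓ ⊔ m ⊔ ℓm ⊔ p)
  HasProjectiveDimension W d = HasDimension W (suc d)

module ProjectiveSpace (F : Field 0ℓ 0ℓ) (n : ℕ) where

  V : LeftModule (Field.ring F) 0ℓ 0ℓ
  V = coordinateModule (Field.ring F) (suc n)

  open LeftModule V
  open LinearAlgebra V

  -- A point is given by homogeneous coordinates; two points are equal
  -- when they span the same one-dimensional subspace.
  record Point : Set where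
    field
      coords  : Carrierᴹ
      nonzero : ¬ (coords ≈ᴹ 0ᴹ)

  open Point

  ⟨_⟩ : Point → Pred Carrierᴹ 0ℓ
  ⟨ P ⟩ v = ∃[ a ] v ≈ᴹ a *ₗ coords P

  points : Setoid 0ℓ 0ℓ
  points = On.setoid (≐-setoid Carrierᴹ 0ℓ) ⟨_⟩

  pointsOf : Subspace 0ℓ → Pred Point 0ℓ
  pointsOf W P = coords P ∈ Subspace.Member W

  -- Meaningful for n ≥ 1, because of the truncated subtraction.
  IsHyperplane : Pred Point 0ℓ → Set₁
  IsHyperplane S = ∃ λ (W : Subspace 0ℓ) → HasProjectiveDimension W (n ∸ℕ 1) × S ≐ pointsOf W

module HyperplaneCode (K F : Field 0ℓ 0ℓ) (n : ℕ) where
  open Field K using (_≈_; 0#; 1#)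
  open ProjectiveSpace F n

  wordSpace : LeftModule (Field.ring K) 0ℓ 0ℓ
  wordSpace = functionModule (Field.ring K) points

  Word : Set
  Word = LeftModule.Carrierᴹ wordSpace

  -- A relation rather than a function of S, as membership in S need
  -- not come with a decision procedure.
  _IsIncidenceVectorOf_ : Word → Pred Point 0ℓ → Set
  v IsIncidenceVectorOf S = ∀ P → (P ∈ S → Func.to v P ≈ 1#) × (P ∉ S → Func.to v P ≈ 0#)

  C : Pred Word (lsuc 0ℓ)
  C = LinearAlgebra.Span wordSpace
        (λ v → ∃[ S ] IsHyperplane S × v IsIncidenceVectorOf S)

module FieldReduction (K F : Field 0ℓ 0ℓ) {ι : Field.Carrier K → Field.Carrier F}
                      (ι-hom : IsRingHomomorphism (Field.rawRing K) (Field.rawRing F) ι)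
                      (n : ℕ) where
  open ProjectiveSpace F n

  -- Fⁿ⁺¹ as a K-vector space, of dimension h(n+1) if F has degree h
  -- over K.  The spread element of P is ⟨ P ⟩, seen inside Vᴷ.
  Vᴷ : LeftModule (Field.ring K) 0ℓ 0ℓ
  Vᴷ = restrictScalars {R = Field.ring K} {S = Field.ring F} ι-hom V

  open LeftModule Vᴷ
  open LinearAlgebra Vᴷ

  -- Disjoint projective subspaces still share the zero vector, so
  -- "meets" asks for a nonzero common vector.
  𝓑 : Subspace 0ℓ → Pred Point 0ℓ
  𝓑 U P = ∃[ v ] ¬ (v ≈ᴹ 0ᴹ) × v ∈ ⟨ P ⟩ × v ∈ Subspace.Member U

  IsSmallLinearBlockingSet : ℕ → Pred Point 0ℓ → Set₁
  IsSmallLinearBlockingSet h S =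
    ∃ λ (U : Subspace 0ℓ) → HasProjectiveDimension U (h *ℕ (n ∸ℕ 1)) × S ≐ 𝓑 U

{-# OPTIONS --safe #-}
-- Let S = 𝓑(U) be covered by the 𝔽p-space U of dimension d = h(n-1)+1, and let e be a point
-- outside S.  For v in the code, x ↦ Σ_t v(⟨x + te⟩) t is the restriction of an 𝔽q-linear
-- functional m: this holds for each hyperplane, as it contains e or meets every line through
-- e in one point, depending linearly on x.  If v is the incidence vector of S, then the only
-- point of S on a tangent line through e lies in the hyperplane m = 0.  Now take an
-- 𝔽p-hyperplane U₀ of U containing U ∩ ker m if U ⊈ ker m, and any U₀ otherwise.  As
-- |U₀| = qⁿ⁻¹, some line through e misses 𝓑(U₀).  Every line meets U, and this one meets it
-- in dimension one, so it is tangent, at a point of S that is spanned by a vector of U \ U₀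
-- in ker m.  Hence U ⊆ ker m, and by counting 𝓑(U) is the hyperplane ker m.
module Submission where

open import Defs
open import Algebra.Bundles using (CommutativeMonoid; Ring)
open import Algebra.Module.Bundles using (LeftModule)
open import Algebra.Module.Construct.DirectProduct using () renaming (leftModule to _×ᴹ_)
open import Algebra.Morphism.Structures using (IsRingHomomorphism)
import Algebra.Properties.CommutativeMonoid.Sum as Sum
import Algebra.Properties.CommutativeSemigroup as CommutativeSemigroupProperties
import Algebra.Properties.Group as GroupProperties
import Algebra.Properties.Ring as RingProperties
import Algebra.Properties.Semiring.Sum as SemiringSum
open import Data.Empty using (⊥)
open import Data.Fin.Base using (Fin; zero; suc; combine; finToFun; funToFin; punchIn; punchOut)
open import Data.Fin.Permutation using (Permutation; permutation)
import Data.Fin.Properties as Fin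
open import Data.Nat.Base using (ℕ; zero; suc; _^_; _<_; _≤_)
import Data.Nat.Base as ℕ
open import Data.Nat.Primality using (Prime)
import Data.Nat.Properties as ℕ
open import Data.Nat.Solver using (module +-*-Solver)
open import Data.Product.Base using (∃; ∃-syntax; ∃₂; _×_; _,_; proj₁; proj₂)
open import Data.Product.Function.NonDependent.Setoid using (_×-inverse_)
open import Data.Product.Relation.Binary.Pointwise.NonDependent using (_×ₛ_)
open import Data.Vec.Functional using (Vector; []; _∷_; insertAt)
open import Data.Vec.Functional.Properties using (insertAt-lookup; insertAt-punchIn)
open import Data.Vec.Functional.Relation.Binary.Equality.Setoid using (≋-setoid)
open import Function.Base using (_∘_; id)
open import Function.Bundles using (Func; Inverse)
open import Function.Properties.Inverse using (↔-sym)
open import Level using (Level; 0ℓ; _⊔_) renaming (suc to lsuc)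
open import Relation.Binary.Bundles using (Setoid)
open import Relation.Binary.Definitions using (_Respects_; Decidable)
open import Relation.Binary.PropositionalEquality as ≡ using (_≡_; _≢_)
import Relation.Binary.Reasoning.Setoid as ≈-Reasoning
open import Relation.Nullary.Decidable using (Dec; yes; no; does; map′; decidable-stable; ¬?; _×-dec_)
open import Relation.Nullary.Negation.Core using (¬_; contradiction)
import Relation.Unary as U
open import Relation.Unary using (Pred; _∈_; _∉_; _⊆_)

-- The weight t in the moment is essential. A linear blocking set meets every line in 1 modulo p
-- points, as a hyperplane does, so unweighted sums along lines cannot tell them apart; the first
-- moment also records where the points lie. Its values are in 𝔽q, so words are carried there by
-- `ι`. Hyperplanes through e contribute a multiple of the sum of all elements of 𝔽q, which vanishes
-- because h > 1 gives q > 2.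
--
-- A line through e misses 𝓑(U₀) because each of the qⁿ⁻¹ - 1 nonzero vectors of U₀ lies on just one
-- of the (qⁿ - 1)/(q - 1) lines through e. It is tangent because two 𝔽p-independent vectors of U on
-- it would have a nonzero combination in U₀.
--
-- No basis of 𝔽q over 𝔽p is ever chosen: the degree enters only through p^d = p qⁿ⁻¹, and dimension
-- arguments that mix the two fields are comparisons of cardinalities. In `Moment` and `LinearSet`
-- the parameter `n` is one less than the projective dimension, so that no truncated subtraction
-- remains and the equation reads p^d = p qⁿ.

private
  variable
    a₁ a₂ b₁ b₂ m₁ m₂ n₁ n₂ p r₁ r₂ : Level

-- Finite setoids: exhaustive search and pigeonhole.

HasSize : Setoid a₁ a₂ → ℕ → Set (a₁ ⊔ a₂)
HasSize X N = Inverse X (≡.setoid (Fin N))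

module Enumeration {X : Setoid a₁ a₂} {N : ℕ} (X# : HasSize X N) where
  open Setoid X
  open Inverse X# public using () renaming (to to encode; from to decode)

  decode-encode : ∀ x → decode (encode x) ≈ x
  decode-encode x = Inverse.inverseʳ X# ≡.refl

  encode-injective : ∀ {x y} → encode x ≡ encode y → x ≈ y
  encode-injective {x} {y} eq =
    trans (sym (decode-encode x)) (trans (reflexive (≡.cong decode eq)) (decode-encode y))

  decode-injective : ∀ {i j} → decode i ≈ decode j → i ≡ j
  decode-injective eq =
    ≡.trans (≡.sym (Inverse.inverseˡ X# refl)) (Inverse.inverseˡ X# eq)

  infix 4 _≟_

  _≟_ : Decidable _≈_
  x ≟ y = map′ encode-injective (Inverse.to-cong X#) (encode x Fin.≟ encode y)

  search : {P : Pred Carrier p} → P Respects _≈_ → U.Decidable P → Dec (∃ P)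
  search resp P? =
    map′ (λ (i , Pi) → decode i , Pi)
         (λ (x , Px) → encode x , resp (sym (decode-encode x)) Px)
         (Fin.any? (P? ∘ decode))

module _ {X : Setoid a₁ a₂} {Y : Setoid b₁ b₂} {M N : ℕ}
         (X# : HasSize X M) (Y# : HasSize Y N) where
  private
    module X = Setoid X
    module Y = Setoid Y
    module EX = Enumeration X#
    module EY = Enumeration Y#

  ×-size : HasSize (X ×ₛ Y) (M ℕ.* N)
  ×-size = record
    { to = λ (x , y) → combine (EX.encode x) (EY.encode y)
    ; from = λ k → Inverse.from (X# ×-inverse Y#) (Inverse.to Fin.*↔× k)
    ; to-cong = λ (x , y) → ≡.cong₂ combine (Inverse.to-cong X# x) (Inverse.to-cong Y# y)
    ; from-cong = λ eq → Setoid.reflexive (X ×ₛ Y)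
        (≡.cong (λ k → Inverse.from (X# ×-inverse Y#) (Inverse.to Fin.*↔× k)) eq)
    ; inverse =
        (λ {k} {z} (e₁ , e₂) → ≡.trans
          (≡.cong₂ combine (Inverse.inverseˡ X# e₁) (Inverse.inverseˡ Y# e₂))
          (Fin.combine-remQuot {M} N k))
      , (λ { {x , y} ≡.refl →
               X.trans (X.reflexive (≡.cong (EX.decode ∘ proj₁) (Fin.remQuot-combine {M} {N} _ _))) (EX.decode-encode x)
             , Y.trans (Y.reflexive (≡.cong (EY.decode ∘ proj₂) (Fin.remQuot-combine {M} {N} _ _))) (EY.decode-encode y) })
    }

  injection⇒≤ : (f : X.Carrier → Y.Carrier) → (∀ {x y} → f x Y.≈ f y → x X.≈ y) → M ≤ N
  injection⇒≤ f f-inj = Fin.injective⇒≤ {f = EY.encode ∘ f ∘ EX.decode}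
    (λ eq → EX.decode-injective (f-inj (EY.encode-injective eq)))

  non-surjective-injection⇒< : (f : X.Carrier → Y.Carrier) → (∀ {x y} → f x Y.≈ f y → x X.≈ y) →
                               ∀ y → (∀ x → ¬ (f x Y.≈ y)) → M < N
  non-surjective-injection⇒< f f-inj y y∉f = Fin.injective⇒≤ {f = g} g-injective
    where
    g : Fin (suc M) → Fin N
    g zero    = EY.encode y
    g (suc i) = EY.encode (f (EX.decode i))

    g-injective : ∀ {i j} → g i ≡ g j → i ≡ j
    g-injective {zero}  {zero}  eq = ≡.refl
    g-injective {zero}  {suc j} eq = contradiction (EY.encode-injective (≡.sym eq)) (y∉f _)
    g-injective {suc i} {zero}  eq = contradiction (EY.encode-injective eq) (y∉f _)
    g-injective {suc i} {suc j} eq =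
      ≡.cong suc (EX.decode-injective (f-inj (EY.encode-injective eq)))

  collision : N < M → (f : X.Carrier → Y.Carrier) → ∃₂ λ x y → ¬ (x X.≈ y) × f x Y.≈ f y
  collision N<M f with Fin.pigeonhole N<M (EY.encode ∘ f ∘ EX.decode)
  ... | i , j , i<j , eq = EX.decode i , EX.decode j
      , (λ eq′ → Fin.<⇒≢ i<j (EX.decode-injective eq′)) , EY.encode-injective eq

funToFin-cong : ∀ {m n} {f g : Fin m → Fin n} → (∀ i → f i ≡ g i) → funToFin f ≡ funToFin g
funToFin-cong {zero}  eq = ≡.refl
funToFin-cong {suc m} eq = ≡.cong₂ combine (eq zero) (funToFin-cong (eq ∘ suc))

vector-size : {X : Setoid a₁ a₂} {N : ℕ} → HasSize X N → ∀ k → HasSize (≋-setoid X k) (N ^ k)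
vector-size {X = X} X# k = record
  { to = λ v → funToFin (encode ∘ v)
  ; from = λ c → decode ∘ finToFun c
  ; to-cong = λ v≈w → funToFin-cong (Inverse.to-cong X# ∘ v≈w)
  ; from-cong = λ { ≡.refl i → refl }
  ; inverse =
      (λ {c} eq → ≡.trans (funToFin-cong (Inverse.inverseˡ X# ∘ eq)) (Fin.funToFin-finToFin {k} c))
    , (λ { {v} ≡.refl i →
             trans (reflexive (≡.cong decode (Fin.finToFun-funToFin (encode ∘ v) i)))
                   (decode-encode (v i)) })
  }
  where
  open Setoid X
  open Enumeration X#

-- Finite sums with at most one nonzero term.

module _ (M : CommutativeMonoid a₁ a₂) where
  open CommutativeMonoid M
  open Sum M

  sum-zero : ∀ {k} (f : Vector Carrier k) → (∀ i → f i ≈ ε) → sum f ≈ ε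
  sum-zero {k} f f≈ε = trans (sum-cong-≋ f≈ε) (sum-replicate-zero k)

  sum-single : ∀ {k} (f : Vector Carrier k) i → (∀ j → j ≢ i → f j ≈ ε) → sum f ≈ f i
  sum-single f zero    rest =
    trans (∙-congˡ (sum-zero (f ∘ suc) (λ j → rest (suc j) (λ ())))) (identityʳ _)
  sum-single f (suc i) rest =
    trans (∙-cong (rest zero (λ ())) (sum-single (f ∘ suc) i (λ j j≢i → rest (suc j) (j≢i ∘ Fin.suc-injective))))
          (identityˡ _)

-- Linear algebra over a field with decidable equality.

module FieldProperties (F : Field r₁ r₂) where
  open Field F hiding (zero)

  leftInverse : ∀ {x} → x ≉ 0# → ∃[ y ] y * x ≈ 1#
  leftInverse x≉0 = let (y , yx≈1 , _) = inverse x≉0 in y , yx≈1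

module FieldModule {F : Field r₁ r₂} (_≟_ : Decidable (Field._≈_ F))
                   (M : LeftModule (Field.ring F) m₁ m₂) where
  open Field F hiding (zero)
  open FieldProperties F
  open LeftModule M
  open LinearAlgebra M
  open GroupProperties +ᴹ-group using () renaming (∙-cancelʳ to +ᴹ-cancelʳ) public
  open CommutativeSemigroupProperties
         (CommutativeMonoid.commutativeSemigroup +ᴹ-commutativeMonoid)
         using () renaming (interchange to +ᴹ-interchange) public
  open ≈-Reasoning ≈ᴹ-setoid

  *ₗ-unscale : ∀ {a b} → b * a ≈ 1# → ∀ v → b *ₗ (a *ₗ v) ≈ᴹ v
  *ₗ-unscale {a} {b} ba≈1 v = begin
    b *ₗ (a *ₗ v)  ≈⟨ *ₗ-assoc b a v ⟨
    (b * a) *ₗ v   ≈⟨ *ₗ-congʳ ba≈1 ⟩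
    1# *ₗ v        ≈⟨ *ₗ-identityˡ v ⟩
    v              ∎

  *ₗ-cancelˡ : ∀ {a u v} → a ≉ 0# → a *ₗ u ≈ᴹ a *ₗ v → u ≈ᴹ v
  *ₗ-cancelˡ {a} {u} {v} a≉0 au≈av = let (b , ba≈1) = leftInverse a≉0 in begin
    u              ≈⟨ *ₗ-unscale ba≈1 u ⟨
    b *ₗ (a *ₗ u)  ≈⟨ *ₗ-congˡ au≈av ⟩
    b *ₗ (a *ₗ v)  ≈⟨ *ₗ-unscale ba≈1 v ⟩
    v              ∎

  *ₗ-nonzero : ∀ {a v} → a ≉ 0# → ¬ v ≈ᴹ 0ᴹ → ¬ a *ₗ v ≈ᴹ 0ᴹ
  *ₗ-nonzero {a} a≉0 v≉0 av≈0 = v≉0 (*ₗ-cancelˡ a≉0 (≈ᴹ-trans av≈0 (≈ᴹ-sym (*ₗ-zeroʳ a))))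

  *ₗ≈0⇒≈0 : ∀ {a v} → ¬ v ≈ᴹ 0ᴹ → a *ₗ v ≈ᴹ 0ᴹ → a ≈ 0#
  *ₗ≈0⇒≈0 {a} v≉0 av≈0 = decidable-stable (a ≟ 0#) (λ a≉0 → *ₗ-nonzero a≉0 v≉0 av≈0)

  *ₗ-subtract : ∀ a b v → a *ₗ v +ᴹ (- 1#) *ₗ (b *ₗ v) ≈ᴹ (a - b) *ₗ v
  *ₗ-subtract a b v = begin
    a *ₗ v +ᴹ (- 1#) *ₗ (b *ₗ v)  ≈⟨ +ᴹ-congˡ (*ₗ-assoc (- 1#) b v) ⟨
    a *ₗ v +ᴹ (- 1# * b) *ₗ v     ≈⟨ +ᴹ-congˡ (*ₗ-congʳ (RingProperties.-1*x≈-x ring b)) ⟩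
    a *ₗ v +ᴹ (- b) *ₗ v          ≈⟨ *ₗ-distribʳ v a (- b) ⟨
    (a - b) *ₗ v                  ∎

  v-v≈0 : ∀ v → v +ᴹ (- 1#) *ₗ v ≈ᴹ 0ᴹ
  v-v≈0 v = begin
    v +ᴹ (- 1#) *ₗ v        ≈⟨ +ᴹ-congʳ (*ₗ-identityˡ v) ⟨
    1# *ₗ v +ᴹ (- 1#) *ₗ v  ≈⟨ *ₗ-distribʳ v 1# (- 1#) ⟨
    (1# - 1#) *ₗ v          ≈⟨ *ₗ-congʳ (-‿inverseʳ 1#) ⟩
    0# *ₗ v                 ≈⟨ *ₗ-zeroˡ v ⟩
    0ᴹ                      ∎

  u-v≈0⇒u≈v : ∀ {u v} → u +ᴹ (- 1#) *ₗ v ≈ᴹ 0ᴹ → u ≈ᴹ v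
  u-v≈0⇒u≈v {u} {v} u-v≈0 = +ᴹ-cancelʳ _ u v (≈ᴹ-trans u-v≈0 (≈ᴹ-sym (v-v≈0 v)))

  u+v≈0⇒u≈-v : ∀ {u v} → u +ᴹ v ≈ᴹ 0ᴹ → u ≈ᴹ (- 1#) *ₗ v
  u+v≈0⇒u≈-v {u} {v} u+v≈0 =
    +ᴹ-cancelʳ v _ _ (≈ᴹ-trans u+v≈0 (≈ᴹ-sym (≈ᴹ-trans (+ᴹ-comm _ _) (v-v≈0 v))))

  module _ (W : Subspace p) where
    open Subspace W

    linearCombination-closed : ∀ {k} a (b : Vector Carrierᴹ k) → (∀ i → b i ∈ Member) →
                               linearCombination a b ∈ Member
    linearCombination-closed {zero}  a b b∈W = 0-closed
    linearCombination-closed {suc k} a b b∈W =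
      +-closed (*ₗ-closed (a zero) (b∈W zero))
               (linearCombination-closed (a ∘ suc) (b ∘ suc) (b∈W ∘ suc))

    unscale-closed : ∀ {a v} → a ≉ 0# → a *ₗ v ∈ Member → v ∈ Member
    unscale-closed {v = v} a≉0 av∈W = let (b , ba≈1) = leftInverse a≉0 in
      resp (*ₗ-unscale ba≈1 v) (*ₗ-closed b av∈W)

    -- The representative is u +ᴹ a *ₗ e, not u -ᴹ a *ₗ e, so that no
    -- subtraction occurs below.
    coefficient-unique : ∀ {e u a b} → e ∉ Member → u +ᴹ a *ₗ e ∈ Member → u +ᴹ b *ₗ e ∈ Member →
                         a ≈ b
    coefficient-unique {e} {u} {a} {b} e∉W a∈ b∈ =
      GroupProperties.x∙y⁻¹≈ε⇒x≈y +-group a b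
        (decidable-stable ((a - b) ≟ 0#) λ a-b≉0 →
          e∉W (unscale-closed a-b≉0 (resp difference (+-closed a∈ (*ₗ-closed (- 1#) b∈)))))
      where
      difference : (u +ᴹ a *ₗ e) +ᴹ (- 1#) *ₗ (u +ᴹ b *ₗ e) ≈ᴹ (a - b) *ₗ e
      difference = begin
        (u +ᴹ a *ₗ e) +ᴹ (- 1#) *ₗ (u +ᴹ b *ₗ e)                  ≈⟨ +ᴹ-congˡ (*ₗ-distribˡ _ _ _) ⟩
        (u +ᴹ a *ₗ e) +ᴹ ((- 1#) *ₗ u +ᴹ (- 1#) *ₗ (b *ₗ e))      ≈⟨ +ᴹ-interchange _ _ _ _ ⟩
        (u +ᴹ (- 1#) *ₗ u) +ᴹ (a *ₗ e +ᴹ (- 1#) *ₗ (b *ₗ e))      ≈⟨ +ᴹ-cong (v-v≈0 u) (*ₗ-subtract a b e) ⟩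
        0ᴹ +ᴹ (a - b) *ₗ e                                        ≈⟨ +ᴹ-identityˡ _ ⟩
        (a - b) *ₗ e                                              ∎

  record Functional : Set (r₁ ⊔ r₂ ⊔ m₁ ⊔ m₂) where
    field
      to     : Carrierᴹ → Carrier
      cong   : ∀ {u v} → u ≈ᴹ v → to u ≈ to v
      +-homo : ∀ u v → to (u +ᴹ v) ≈ to u + to v
      *-homo : ∀ a v → to (a *ₗ v) ≈ a * to v

    0-homo : to 0ᴹ ≈ 0#
    0-homo = trans (cong (≈ᴹ-sym (*ₗ-zeroˡ 0ᴹ))) (trans (*-homo 0# 0ᴹ) (zeroˡ _))

    combination-homo : ∀ a u b v → to (a *ₗ u +ᴹ b *ₗ v) ≈ a * to u + b * to v
    combination-homo a u b v = trans (+-homo _ _) (+-cong (*-homo a u) (*-homo b v))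

    to-linearCombination : ∀ {k} a (b : Vector Carrierᴹ k) →
                           (∀ i → to (b i) ≈ 0#) → to (linearCombination a b) ≈ 0#
    to-linearCombination {zero}  a b b≈0 = 0-homo
    to-linearCombination {suc k} a b b≈0 = trans (+-homo _ _) (trans
      (+-cong (trans (*-homo _ _) (trans (*-congˡ (b≈0 zero)) (zeroʳ _)))
              (to-linearCombination (a ∘ suc) (b ∘ suc) (b≈0 ∘ suc)))
      (+-identityˡ 0#))

    kernel : Subspace r₂
    kernel = record
      { Member    = λ v → to v ≈ 0#
      ; resp      = λ u≈v u∈ker → trans (cong (≈ᴹ-sym u≈v)) u∈ker
      ; 0-closed  = 0-homo
      ; +-closed  = λ u∈ker v∈ker → trans (+-homo _ _) (trans (+-cong u∈ker v∈ker) (+-identityˡ 0#))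
      ; *ₗ-closed = λ a v∈ker → trans (*-homo a _) (trans (*-congˡ v∈ker) (zeroʳ a))
      }

  zeroSubspace : Subspace m₂
  zeroSubspace = record
    { Member    = _≈ᴹ 0ᴹ
    ; resp      = λ u≈v u≈0 → ≈ᴹ-trans (≈ᴹ-sym u≈v) u≈0
    ; 0-closed  = ≈ᴹ-refl
    ; +-closed  = λ u≈0 v≈0 → ≈ᴹ-trans (+ᴹ-cong u≈0 v≈0) (+ᴹ-identityˡ 0ᴹ)
    ; *ₗ-closed = λ a v≈0 → ≈ᴹ-trans (*ₗ-congˡ v≈0) (*ₗ-zeroʳ a)
    }

  module _ (W : Subspace p) {e} (e∉W : e ∉ Subspace.Member W)
           (split : ∀ v → ∃[ a ] v +ᴹ a *ₗ e ∈ Subspace.Member W) where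
    open Subspace W

    -- Minus the coordinate along `e` in the decomposition of the module as W ⊕ ⟨e⟩. Linearity
    -- follows from the uniqueness of the coefficient alone, without a basis.
    complementFunctional : Functional
    complementFunctional = record
      { to     = proj₁ ∘ split
      ; cong   = λ {u} {v} u≈v → unique (resp (+ᴹ-congʳ u≈v) (proj₂ (split u))) (proj₂ (split v))
      ; +-homo = λ u v → unique (proj₂ (split (u +ᴹ v)))
          (resp (≈ᴹ-trans (+ᴹ-interchange _ _ _ _) (+ᴹ-congˡ (≈ᴹ-sym (*ₗ-distribʳ e _ _))))
                (+-closed (proj₂ (split u)) (proj₂ (split v))))
      ; *-homo = λ a v → unique (proj₂ (split (a *ₗ v)))
          (resp (≈ᴹ-trans (*ₗ-distribˡ a _ _) (+ᴹ-congˡ (≈ᴹ-sym (*ₗ-assoc a _ e))))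
                (*ₗ-closed a (proj₂ (split v))))
      }
      where
      unique : ∀ {u a b} → u +ᴹ a *ₗ e ∈ Member → u +ᴹ b *ₗ e ∈ Member → a ≈ b
      unique = coefficient-unique W e∉W

    open Functional complementFunctional

    complementFunctional-kernel : ∀ {v} → v ∈ Member → to v ≈ 0#
    complementFunctional-kernel {v} v∈W = coefficient-unique W e∉W (proj₂ (split v))
      (resp (≈ᴹ-sym (≈ᴹ-trans (+ᴹ-congˡ (*ₗ-zeroˡ e)) (+ᴹ-identityʳ v))) v∈W)

    complementFunctional-nonzero : to e ≉ 0#
    complementFunctional-nonzero τe≈0 = e∉W (resp
      (≈ᴹ-trans (+ᴹ-congˡ (≈ᴹ-trans (*ₗ-congʳ τe≈0) (*ₗ-zeroˡ e))) (+ᴹ-identityʳ e))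
      (proj₂ (split e)))

-- Separating a vector from a subspace by a functional.

module _ {F : Field r₁ r₂} {q : ℕ} (F# : HasOrder F q)
         (M : LeftModule (Field.ring F) m₁ m₂) where
  open Field F hiding (zero)
  open FieldProperties F
  open LeftModule M
  open LinearAlgebra M
  open FieldModule {F = F} (Enumeration._≟_ F#) M
  open Enumeration F# using (search; _≟_)
  open Subspace

  -- Greedily enlarging W while avoiding e makes Member ⊕ ⟨e⟩ contain any given finite family.
  record Avoiding (W : Subspace (r₁ ⊔ m₂)) (e : Carrierᴹ) {k} (v : Vector Carrierᴹ k)
                  : Set (lsuc (r₁ ⊔ m₁ ⊔ m₂) ⊔ r₂) where
    field
      space   : Subspace (r₁ ⊔ m₂)
      member? : U.Decidable (Member space)
      W⊆space : Member W ⊆ Member space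
      e∉space : e ∉ Member space
      split   : ∀ i → ∃[ a ] v i +ᴹ a *ₗ e ∈ Member space

  avoiding : ∀ W → U.Decidable (Member W) → ∀ {e} → e ∉ Member W →
             ∀ {k} (v : Vector Carrierᴹ k) → Avoiding W e v
  avoiding W W? e∉W {zero} v = record
    { space = W ; member? = W? ; W⊆space = λ w → w ; e∉space = e∉W ; split = λ () }
  avoiding W W? {e} e∉W {suc k} v
    with avoiding W W? e∉W (v ∘ suc)
  ... | A with search {P = λ a → v zero +ᴹ a *ₗ e ∈ Member (Avoiding.space A)}
                      (λ a≈b → resp (Avoiding.space A) (+ᴹ-congˡ (*ₗ-congʳ a≈b)))
                      (λ a → Avoiding.member? A (v zero +ᴹ a *ₗ e))
  ... | yes found = record
    { space = space ; member? = member? ; W⊆space = W⊆space ; e∉space = e∉space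
    ; split = λ { zero → found ; (suc i) → split i } }
    where open Avoiding A
  -- Now `v zero` lies outside `space` ⊕ ⟨e⟩ and is adjoined. The larger space still avoids `e`: if
  -- e + a v₀ were in the old one, then a = 0 would put `e` there, and a ≠ 0 would put v₀ into
  -- `space` ⊕ ⟨e⟩.
  ... | no ∄ = record
    { space   = space′
    ; member? = λ u → search (λ a≈b → resp space (+ᴹ-congˡ (*ₗ-congʳ a≈b)))
                             (λ a → member? (u +ᴹ a *ₗ v zero))
    ; W⊆space = ⊆space′ ∘ W⊆space
    ; e∉space = e∉space′
    ; split   = λ { zero → 0# , - 1# , resp space (≈ᴹ-sym v₀∈) (0-closed space)
                  ; (suc i) → let (a , a∈) = split i in a , ⊆space′ a∈ }
    }
    where
    open Avoiding A

    space′ : Subspace (r₁ ⊔ m₂)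
    space′ = record
      { Member = λ u → ∃[ a ] u +ᴹ a *ₗ v zero ∈ Member space
      ; resp = λ u≈w (a , a∈) → a , resp space (+ᴹ-congʳ u≈w) a∈
      ; 0-closed = 0# , resp space
          (≈ᴹ-sym (≈ᴹ-trans (+ᴹ-congˡ (*ₗ-zeroˡ _)) (+ᴹ-identityˡ _))) (0-closed space)
      ; +-closed = λ (a , a∈) (b , b∈) → a + b , resp space
          (≈ᴹ-trans (+ᴹ-interchange _ _ _ _) (+ᴹ-congˡ (≈ᴹ-sym (*ₗ-distribʳ _ a b))))
          (+-closed space a∈ b∈)
      ; *ₗ-closed = λ b (a , a∈) → b * a , resp space
          (≈ᴹ-trans (*ₗ-distribˡ b _ _) (+ᴹ-congˡ (≈ᴹ-sym (*ₗ-assoc b a _))))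
          (*ₗ-closed space b a∈)
      }

    ⊆space′ : Member space ⊆ Member space′
    ⊆space′ u∈ = 0# , resp space
      (≈ᴹ-sym (≈ᴹ-trans (+ᴹ-congˡ (*ₗ-zeroˡ _)) (+ᴹ-identityʳ _))) u∈

    v₀∈ : (v zero +ᴹ 0# *ₗ e) +ᴹ (- 1#) *ₗ v zero ≈ᴹ 0ᴹ
    v₀∈ = ≈ᴹ-trans (+ᴹ-congʳ (≈ᴹ-trans (+ᴹ-congˡ (*ₗ-zeroˡ e)) (+ᴹ-identityʳ _))) (v-v≈0 _)

    e∉space′ : e ∉ Member space′
    e∉space′ (a , a∈) with a ≟ 0#
    ... | yes a≈0 = e∉space (resp space
      (≈ᴹ-trans (+ᴹ-congˡ (≈ᴹ-trans (*ₗ-congʳ a≈0) (*ₗ-zeroˡ _))) (+ᴹ-identityʳ e)) a∈)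
    ... | no a≉0 = let (b , ba≈1) = leftInverse a≉0 in ∄ (b , resp space
      (≈ᴹ-trans (*ₗ-distribˡ b _ _) (≈ᴹ-trans (+ᴹ-congˡ (*ₗ-unscale ba≈1 _)) (+ᴹ-comm _ _)))
      (*ₗ-closed space b a∈))

  -- Running the greedy construction through a list of all vectors makes `space` a complement of ⟨e⟩
  -- that contains `W`; its complement functional separates.
  separatingFunctional : ∀ {N} → HasSize ≈ᴹ-setoid N →
    ∀ W → U.Decidable (Member W) → ∀ {e} → e ∉ Member W →
    ∃[ ψ ] (∀ {v} → v ∈ Member W → Functional.to ψ v ≈ 0#) × Functional.to ψ e ≉ 0#
  separatingFunctional M# W W? e∉W =
      complementFunctional space e∉space split-all
    , (λ v∈W → complementFunctional-kernel space e∉space split-all (W⊆space v∈W))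
    , complementFunctional-nonzero space e∉space split-all
    where
    open Enumeration M#
    open Avoiding (avoiding W W? e∉W decode)

    split-all : ∀ v → ∃[ a ] v +ᴹ a *ₗ _ ∈ Member space
    split-all v = let (a , a∈) = split (encode v) in
      a , resp space (+ᴹ-congʳ (decode-encode v)) a∈

-- Linear combinations, and kernels by counting.

module LinearCombination {R : Ring r₁ r₂} (M : LeftModule R m₁ m₂) where
  open Ring R hiding (zero)
  open LeftModule M
  open LinearAlgebra M
  open CommutativeSemigroupProperties
         (CommutativeMonoid.commutativeSemigroup +ᴹ-commutativeMonoid)
         using () renaming (interchange to +ᴹ-interchange)

  linearCombination-cong : ∀ {k} {a a′ : Vector Carrier k} {b b′ : Vector Carrierᴹ k} →
    (∀ i → a i ≈ a′ i) → (∀ i → b i ≈ᴹ b′ i) → linearCombination a b ≈ᴹ linearCombination a′ b′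
  linearCombination-cong a≈a′ b≈b′ = Sum.sum-cong-≋ +ᴹ-commutativeMonoid (λ i → *ₗ-cong (a≈a′ i) (b≈b′ i))

  linearCombination-homo : ∀ {k} a s a′ (b : Vector Carrierᴹ k) →
    linearCombination (λ i → a i + s * a′ i) b ≈ᴹ linearCombination a b +ᴹ s *ₗ linearCombination a′ b
  linearCombination-homo {zero}  a s a′ b = ≈ᴹ-sym (≈ᴹ-trans (+ᴹ-identityˡ _) (*ₗ-zeroʳ s))
  linearCombination-homo {suc k} a s a′ b = begin
    (a zero + s * a′ zero) *ₗ b zero +ᴹ linearCombination (λ i → a (suc i) + s * a′ (suc i)) (b ∘ suc)
      ≈⟨ +ᴹ-cong (≈ᴹ-trans (*ₗ-distribʳ _ _ _) (+ᴹ-congˡ (*ₗ-assoc s _ _)))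
                 (linearCombination-homo (a ∘ suc) s (a′ ∘ suc) (b ∘ suc)) ⟩
    (a zero *ₗ b zero +ᴹ s *ₗ (a′ zero *ₗ b zero))
      +ᴹ (linearCombination (a ∘ suc) (b ∘ suc) +ᴹ s *ₗ linearCombination (a′ ∘ suc) (b ∘ suc))
      ≈⟨ +ᴹ-interchange _ _ _ _ ⟩
    linearCombination a b +ᴹ (s *ₗ (a′ zero *ₗ b zero) +ᴹ s *ₗ linearCombination (a′ ∘ suc) (b ∘ suc))
      ≈⟨ +ᴹ-congˡ (*ₗ-distribˡ s _ _) ⟨
    linearCombination a b +ᴹ s *ₗ linearCombination a′ b ∎
    where open ≈-Reasoning ≈ᴹ-setoid

  linearCombination-zero : ∀ {k} {a} (b : Vector Carrierᴹ k) → (∀ i → a i ≈ 0#) →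
                           linearCombination a b ≈ᴹ 0ᴹ
  linearCombination-zero b a≈0 =
    sum-zero +ᴹ-commutativeMonoid _ (λ i → ≈ᴹ-trans (*ₗ-congʳ (a≈0 i)) (*ₗ-zeroˡ _))

module _ {F : Field r₁ r₂} (_≟_ : Decidable (Field._≈_ F))
         (M : LeftModule (Field.ring F) m₁ m₂) (N : LeftModule (Field.ring F) n₁ n₂) where
  open Field F using (_≈_; -_; 1#)
  private
    module M = LeftModule M
    module N = LeftModule N

  -- Pigeonhole in place of rank-nullity: two distinct vectors have the same image, and their
  -- difference is the kernel vector.
  nontrivialKernel : ∀ {#M #N} → HasSize M.≈ᴹ-setoid #M → HasSize N.≈ᴹ-setoid #N → #N < #M →
    (f : M.Carrierᴹ → N.Carrierᴹ) → (∀ u a v → f (u M.+ᴹ a M.*ₗ v) N.≈ᴹ f u N.+ᴹ a N.*ₗ f v) →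
    ∃[ v ] ¬ v M.≈ᴹ M.0ᴹ × f v N.≈ᴹ N.0ᴹ
  nontrivialKernel M# N# #N<#M f f-homo =
    let (u , v , u≉v , fu≈fv) = collision M# N# #N<#M f in
      u M.+ᴹ (- 1#) M.*ₗ v
    , u≉v ∘ FieldModule.u-v≈0⇒u≈v {F = F} _≟_ M
    , N.≈ᴹ-trans (f-homo u (- 1#) v) (N.≈ᴹ-trans (N.+ᴹ-congʳ fu≈fv) (FieldModule.v-v≈0 {F = F} _≟_ N (f v)))

-- The sum of all elements of a finite field.

module FiniteField {F : Field r₁ r₂} {q : ℕ} (F# : HasOrder F q) where
  open Field F hiding (zero)
  open Enumeration F# public

  coordinates# : ∀ k → HasSize (LeftModule.≈ᴹ-setoid (coordinateModule ring k)) (q ^ k)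
  coordinates# = vector-size F#

  1<q : 1 < q
  1<q with q ℕ.≤? 1
  ... | no q≰1 = ℕ.≰⇒> q≰1
  ... | yes q≤1 = contradiction (encode-injective (≤1⇒≡ q≤1 (encode 1#) (encode 0#))) 1≉0
    where
    ≤1⇒≡ : ∀ {k} → k ≤ 1 → (i j : Fin k) → i ≡ j
    ≤1⇒≡ (ℕ.s≤s ℕ.z≤n) zero zero = ≡.refl

  open SemiringSum semiring public
  open ≈-Reasoning setoid

  module _ {g} (g≉0 : g ≉ 0#) where
    private
      g⁻¹ = proj₁ (inverse g≉0)

    multiplication : Permutation q q
    multiplication = permutation
      (λ i → encode (g * decode i)) (λ i → encode (g⁻¹ * decode i))
      (λ i → undo (proj₂ (proj₂ (inverse g≉0))) i) (λ i → undo (proj₁ (proj₂ (inverse g≉0))) i)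
      where
      undo : ∀ {x y} → x * y ≈ 1# → ∀ i → encode (x * decode (encode (y * decode i))) ≡ i
      undo {x} {y} xy≈1 i = decode-injective (begin
        decode (encode (x * decode (encode (y * decode i))))  ≈⟨ decode-encode _ ⟩
        x * decode (encode (y * decode i))                    ≈⟨ *-congˡ (decode-encode _) ⟩
        x * (y * decode i)                                    ≈⟨ *-assoc x y _ ⟨
        (x * y) * decode i                                    ≈⟨ *-congʳ xy≈1 ⟩
        1# * decode i                                         ≈⟨ *-identityˡ _ ⟩
        decode i                                              ∎)

    sum-elements-invariant : g * sum decode ≈ sum decode
    sum-elements-invariant = begin
      g * sum decode                           ≈⟨ *-distribˡ-sum g decode ⟩
      sum (λ i → g * decode i)                 ≈⟨ sum-cong-≋ (λ i → decode-encode (g * decode i)) ⟨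
      sum (λ i → decode (encode (g * decode i))) ≈⟨ sum-permute decode multiplication ⟨
      sum decode                               ∎

  -- If the sum S were nonzero, g S = S would force every nonzero g to be 1. Testing for zero would
  -- then embed the field into the Booleans.
  sum-elements : 2 < q → sum decode ≈ 0#
  sum-elements 2<q = decidable-stable (sum decode ≟ 0#) λ S≉0 →
    ℕ.<⇒≱ 2<q (injection⇒≤ F# (↔-sym Fin.2↔Bool) (λ x → does (x ≟ 0#))
      (same-zeroness S≉0 (_ ≟ 0#) (_ ≟ 0#)))
    where
    fixed : sum decode ≉ 0# → ∀ {g} → g ≉ 0# → g ≈ 1#
    fixed S≉0 {g} g≉0 = let (s , _ , Ss≈1) = inverse S≉0 in begin
      g                     ≈⟨ *-identityʳ g ⟨
      g * 1#                ≈⟨ *-congˡ Ss≈1 ⟨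
      g * (sum decode * s)  ≈⟨ *-assoc g _ s ⟨
      g * sum decode * s    ≈⟨ *-congʳ (sum-elements-invariant g≉0) ⟩
      sum decode * s        ≈⟨ Ss≈1 ⟩
      1#                    ∎

    same-zeroness : sum decode ≉ 0# → ∀ {x y} (x? : Dec (x ≈ 0#)) (y? : Dec (y ≈ 0#)) →
                    does x? ≡ does y? → x ≈ y
    same-zeroness S≉0 (yes x≈0) (yes y≈0) _ = trans x≈0 (sym y≈0)
    same-zeroness S≉0 (no x≉0)  (no y≉0)  _ = trans (fixed S≉0 x≉0) (sym (fixed S≉0 y≉0))

-- Finite vector spaces and their hyperplanes.

module FiniteModule {F : Field r₁ r₂} {q : ℕ} (F# : HasOrder F q) (M : LeftModule (Field.ring F) m₁ m₂)
                    (_≟ᴹ_ : Decidable (LeftModule._≈ᴹ_ M)) where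
  open Field F hiding (zero)
  open LeftModule M
  open LinearAlgebra M
  open FieldModule {F = F} (Enumeration._≟_ F#) M
  open LinearCombination M

  basis⇒member? : ∀ (W : Subspace p) {k} {b : Vector Carrierᴹ k} → IsBasis W b →
                  U.Decidable (Subspace.Member W)
  basis⇒member? W {k} {b} basis v =
    map′ (λ (a , v≈ab) → Subspace.resp W (≈ᴹ-sym v≈ab) (linearCombination-closed W a b members))
         spanning
         (Enumeration.search (vector-size F# k)
           (λ a≈a′ v≈ab → ≈ᴹ-trans v≈ab (linearCombination-cong a≈a′ (λ _ → ≈ᴹ-refl)))
           (λ a → v ≟ᴹ linearCombination a b))
    where open IsBasis basis

module FiniteVectorSpace {F : Field 0ℓ 0ℓ} {q : ℕ} (F# : HasOrder F q) (k : ℕ) where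
  open Field F hiding (zero)
  open FieldProperties F
  open FiniteField {F = F} F# using (coordinates#; 1<q; _≟_)

  V : LeftModule ring 0ℓ 0ℓ
  V = coordinateModule ring k

  open LeftModule V
  open LinearAlgebra V
  open FieldModule {F = F} _≟_ V public
  open LinearCombination V public
  open Enumeration (coordinates# k) public using () renaming (_≟_ to _≟ᴹ_; search to searchᴹ)
  open FiniteModule {F = F} F# V _≟ᴹ_ public

  dependent : (b : Vector Carrierᴹ (suc k)) →
              ∃[ a ] ¬ (∀ i → a i ≈ 0#) × linearCombination a b ≈ᴹ 0ᴹ
  dependent b = nontrivialKernel {F = F} _≟_ (coordinateModule ring (suc k)) V
    (coordinates# (suc k)) (coordinates# k) (ℕ.^-monoʳ-< q 1<q (ℕ.n<1+n k))
    (λ a → linearCombination a b) (λ a s a′ → linearCombination-homo a s a′ b)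

  -- The l + 2 vectors e, x and `b` are dependent in dimension l + 1. The coefficient of x cannot
  -- vanish: that of e would vanish too, as e is outside `W`, and the rest would contradict the
  -- independence of `b`.
  hyperplane-split : ∀ {l} → k ≡ suc l → (W : Subspace p) → HasDimension W l →
    ∀ {e} → e ∉ Subspace.Member W → ∀ x → ∃[ t ] x +ᴹ t *ₗ e ∈ Subspace.Member W
  hyperplane-split ≡.refl W (b , basis) {e} e∉W x with dependent (e ∷ x ∷ b)
  ... | a , a≉0 , ab≈0 = s * a zero , resp
      (≈ᴹ-trans (*ₗ-distribˡ s _ _) (+ᴹ-cong (*ₗ-unscale sa₁≈1 x) (≈ᴹ-sym (*ₗ-assoc s _ e))))
      (*ₗ-closed s a₁x+a₀e∈W)
    where
    open Subspace W
    open IsBasis basis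
    open ≈-Reasoning ≈ᴹ-setoid

    a′ = λ i → a (suc (suc i))
    w = linearCombination a′ b

    w∈W : w ∈ Member
    w∈W = linearCombination-closed W a′ b members

    a₁x+a₀e∈W : a (suc zero) *ₗ x +ᴹ a zero *ₗ e ∈ Member
    a₁x+a₀e∈W = resp (≈ᴹ-sym (u+v≈0⇒u≈-v (begin
      (a (suc zero) *ₗ x +ᴹ a zero *ₗ e) +ᴹ w  ≈⟨ +ᴹ-congʳ (+ᴹ-comm _ _) ⟩
      (a zero *ₗ e +ᴹ a (suc zero) *ₗ x) +ᴹ w  ≈⟨ +ᴹ-assoc _ _ _ ⟩
      linearCombination a (e ∷ x ∷ b)          ≈⟨ ab≈0 ⟩
      0ᴹ                                       ∎))) (*ₗ-closed (- 1#) w∈W)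

    a₁≉0 : a (suc zero) ≉ 0#
    a₁≉0 a₁≈0 = a≉0 λ { zero → a₀≈0 ; (suc zero) → a₁≈0 ; (suc (suc i)) → independent _ w≈0 i }
      where
      a₁x≈0 : a (suc zero) *ₗ x ≈ᴹ 0ᴹ
      a₁x≈0 = ≈ᴹ-trans (*ₗ-congʳ a₁≈0) (*ₗ-zeroˡ x)

      a₀≈0 : a zero ≈ 0#
      a₀≈0 = decidable-stable (a zero ≟ 0#) λ a₀≉0 → e∉W (unscale-closed W a₀≉0
        (resp (≈ᴹ-trans (+ᴹ-congʳ a₁x≈0) (+ᴹ-identityˡ _)) a₁x+a₀e∈W))

      w≈0 : w ≈ᴹ 0ᴹ
      w≈0 = begin
        w                                ≈⟨ +ᴹ-identityˡ w ⟨
        0ᴹ +ᴹ w                          ≈⟨ +ᴹ-congʳ a₁x≈0 ⟨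
        a (suc zero) *ₗ x +ᴹ w           ≈⟨ +ᴹ-identityˡ _ ⟨
        0ᴹ +ᴹ (a (suc zero) *ₗ x +ᴹ w)   ≈⟨ +ᴹ-congʳ (≈ᴹ-trans (*ₗ-congʳ a₀≈0) (*ₗ-zeroˡ e)) ⟨
        linearCombination a (e ∷ x ∷ b)  ≈⟨ ab≈0 ⟩
        0ᴹ                               ∎

    s = proj₁ (leftInverse a₁≉0)
    sa₁≈1 = proj₂ (leftInverse a₁≉0)

-- First moments of codewords along the lines through e.

module Moment (K F : Field 0ℓ 0ℓ) {q : ℕ} (F# : HasOrder F q) (2<q : 2 < q)
              {ι : Field.Carrier K → Field.Carrier F}
              (ι-hom : IsRingHomomorphism (Field.rawRing K) (Field.rawRing F) ι)
              (n : ℕ) (e : Vector (Field.Carrier F) (suc (suc n))) where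
  open Field F hiding (zero)
  open FiniteField {F = F} F#
  open FiniteVectorSpace {F = F} F# (suc (suc n)) hiding (V)
  open ProjectiveSpace F (suc n)
  open HyperplaneCode K F (suc n) using (Word; wordSpace; _IsIncidenceVectorOf_; C)
  open LeftModule V
  open LinearAlgebra V
  private
    module K = Field K
    module ι = IsRingHomomorphism ι-hom
    module W = LeftModule wordSpace
    module WL = LinearAlgebra wordSpace

  OffCentre : Carrierᴹ → Set
  OffCentre x = ∀ t → ¬ x +ᴹ t *ₗ e ≈ᴹ 0ᴹ

  linePoint : ∀ x → OffCentre x → Carrier → Point
  linePoint x x-off t = record { coords = x +ᴹ t *ₗ e ; nonzero = x-off t }

  -- The point ⟨e⟩ of the line is left out. The value depends on the vector x and not only on the
  -- line: replacing x by x + se shifts the parameter of every point by s.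
  moment : Word → ∀ x → OffCentre x → Carrier
  moment w x x-off = sum (λ i → ι (Func.to w (linePoint x x-off (decode i))) * decode i)

  HasLinearMoment : Word → Set
  HasLinearMoment w = ∃[ μ ] ∀ x x-off → moment w x x-off ≈ Functional.to μ x

  zeroFunctional : Functional
  zeroFunctional = record
    { to = λ _ → 0# ; cong = λ _ → refl
    ; +-homo = λ _ _ → sym (+-identityˡ 0#) ; *-homo = λ a _ → sym (zeroʳ a) }

  moment-zero : HasLinearMoment W.0ᴹ
  moment-zero = zeroFunctional , λ x x-off →
    sum-zero +-commutativeMonoid (λ i → ι K.0# * decode i) (λ i → trans (*-congʳ ι.0#-homo) (zeroˡ _))

  moment-cong : ∀ v w → v W.≈ᴹ w → HasLinearMoment w → HasLinearMoment v
  moment-cong v w v≈w (μ , eq) = μ , λ x x-off →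
    trans (sum-cong-≋ (λ i → *-congʳ (ι.⟦⟧-cong (v≈w (linePoint x x-off (decode i)))))) (eq x x-off)

  moment-combination : ∀ a v w → HasLinearMoment v → HasLinearMoment w →
                       HasLinearMoment (a W.*ₗ v W.+ᴹ w)
  moment-combination a v w (μ , μ-eq) (ν , ν-eq) = functional , λ x x-off → let
      v′ i = ι (Func.to v (linePoint x x-off (decode i)))
      w′ i = ι (Func.to w (linePoint x x-off (decode i)))
    in begin
      moment (a W.*ₗ v W.+ᴹ w) x x-off
        ≈⟨ sum-cong-≋ (λ i → trans (*-congʳ (trans (ι.+-homo _ _) (+-congʳ (ι.*-homo a _))))
             (trans (distribʳ _ _ _) (+-congʳ (*-assoc (ι a) (v′ i) _)))) ⟩
      sum (λ i → ι a * (v′ i * decode i) + w′ i * decode i)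
        ≈⟨ ∑-distrib-+ (λ i → ι a * (v′ i * decode i)) (λ i → w′ i * decode i) ⟩
      sum (λ i → ι a * (v′ i * decode i)) + moment w x x-off
        ≈⟨ +-congʳ (*-distribˡ-sum (ι a) (λ i → v′ i * decode i)) ⟨
      ι a * moment v x x-off + moment w x x-off
        ≈⟨ +-cong (*-congˡ (μ-eq x x-off)) (ν-eq x x-off) ⟩
      ι a * μ.to x + ν.to x ∎
    where
    module μ = Functional μ
    module ν = Functional ν
    open ≈-Reasoning setoid
    open CommutativeSemigroupProperties +-commutativeSemigroup using (interchange)
    open CommutativeSemigroupProperties *-commutativeSemigroup using (x∙yz≈y∙xz)

    functional : Functional
    functional = record
      { to     = λ x → ι a * μ.to x + ν.to x
      ; cong   = λ x≈y → +-cong (*-congˡ (μ.cong x≈y)) (ν.cong x≈y)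
      ; +-homo = λ x y → trans
          (+-cong (trans (*-congˡ (μ.+-homo x y)) (distribˡ _ _ _)) (ν.+-homo x y))
          (interchange _ _ _ _)
      ; *-homo = λ b x → trans
          (+-cong (trans (*-congˡ (μ.*-homo b x)) (x∙yz≈y∙xz _ _ _)) (ν.*-homo b x))
          (sym (distribˡ b _ _))
      }

  moment-linearCombination : ∀ {k} a (b : Vector Word k) → (∀ i → HasLinearMoment (b i)) →
                             HasLinearMoment (WL.linearCombination a b)
  moment-linearCombination {zero}  a b b-lin = moment-zero
  moment-linearCombination {suc k} a b b-lin =
    moment-combination (a zero) (b zero) (WL.linearCombination (a ∘ suc) (b ∘ suc))
      (b-lin zero) (moment-linearCombination (a ∘ suc) (b ∘ suc) (b-lin ∘ suc))

  -- Only the term at t₀ survives, and its weight is t₀. This serves both the hyperplanes that miss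
  -- e and the blocking set on its tangent lines.
  moment-tangent : ∀ {S w} → w IsIncidenceVectorOf S → ∀ {x} x-off t₀ →
    (∀ {t} → linePoint x x-off t ∈ S → t ≈ t₀) → (∀ {t} → t ≈ t₀ → linePoint x x-off t ∈ S) →
    moment w x x-off ≈ t₀
  moment-tangent {S} {w} w-inc {x} x-off t₀ ∈S⇒≈t₀ ≈t₀⇒∈S = begin
    moment w x x-off  ≈⟨ sum-single +-commutativeMonoid f (encode t₀) off ⟩
    f (encode t₀)     ≈⟨ *-cong (trans (ι.⟦⟧-cong on) ι.1#-homo) (decode-encode t₀) ⟩
    1# * t₀           ≈⟨ *-identityˡ t₀ ⟩
    t₀                ∎
    where
    open ≈-Reasoning setoid

    P : Fin q → Point
    P i = linePoint x x-off (decode i)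

    f : Fin q → Carrier
    f i = ι (Func.to w (P i)) * decode i

    off : ∀ i → i ≢ encode t₀ → f i ≈ 0#
    off i i≢ = trans (*-congʳ (trans (ι.⟦⟧-cong (proj₂ (w-inc (P i))
      λ P∈S → i≢ (decode-injective (trans (∈S⇒≈t₀ P∈S) (sym (decode-encode t₀)))))) ι.0#-homo)) (zeroˡ _)

    on : Func.to w (P (encode t₀)) K.≈ K.1#
    on = proj₁ (w-inc (P (encode t₀))) (≈t₀⇒∈S (decode-encode t₀))

  -- Either W contains the centre e, so that the word is constant on lines through e, or W
  -- meets each such line in exactly one point, whose coordinate depends linearly on the line.
  moment-hyperplane : ∀ {S w} → IsHyperplane S → w IsIncidenceVectorOf S → HasLinearMoment w
  moment-hyperplane {S} {w} (W , W-dim@(b , basis) , S⊆W , W⊆S) w-inc with basis⇒member? W basis e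
  ... | yes e∈W = zeroFunctional , λ x x-off → let
      κ , const = constant x x-off
    in begin
      moment w x x-off            ≈⟨ sum-cong-≋ (λ i → *-congʳ (ι.⟦⟧-cong (const (decode i)))) ⟩
      sum (λ i → ι κ * decode i)  ≈⟨ *-distribˡ-sum (ι κ) decode ⟨
      ι κ * sum decode            ≈⟨ *-congˡ (sum-elements 2<q) ⟩
      ι κ * 0#                    ≈⟨ zeroʳ _ ⟩
      0#                          ∎
    where
    open ≈-Reasoning setoid
    open Subspace W

    constant : ∀ x x-off → ∃[ κ ] ∀ t → Func.to w (linePoint x x-off t) K.≈ κ
    constant x x-off with basis⇒member? W basis x
    ... | yes x∈W = K.1# , λ t → proj₁ (w-inc (linePoint x x-off t)) (W⊆S (+-closed x∈W (*ₗ-closed t e∈W)))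
    ... | no x∉W = K.0# , λ t → proj₂ (w-inc (linePoint x x-off t)) λ P∈S →
      x∉W (resp (line-back x t) (+-closed (S⊆W P∈S) (*ₗ-closed (- 1#) (*ₗ-closed t e∈W))))
      where
      line-back : ∀ x t → (x +ᴹ t *ₗ e) +ᴹ (- 1#) *ₗ (t *ₗ e) ≈ᴹ x
      line-back x t = ≈ᴹ-trans (+ᴹ-assoc _ _ _) (≈ᴹ-trans (+ᴹ-congˡ (v-v≈0 _)) (+ᴹ-identityʳ x))
  ... | no e∉W = complementFunctional W e∉W split , λ x x-off →
    moment-tangent {S} {w} w-inc x-off (proj₁ (split x))
      (λ P∈S → coefficient-unique W e∉W (S⊆W P∈S) (proj₂ (split x)))
      (λ t≈t₀ → W⊆S (Subspace.resp W (+ᴹ-congˡ (*ₗ-congʳ (sym t≈t₀))) (proj₂ (split x))))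
    where
    split = hyperplane-split ≡.refl W W-dim e∉W

  codeword-moment : ∀ {v} → v ∈ C → HasLinearMoment v
  codeword-moment {v} (k , a , b , b∈ , v≈ab) = moment-cong v (WL.linearCombination a b) v≈ab
    (moment-linearCombination a b (λ i → let (S , hyp , inc) = b∈ i in moment-hyperplane {S} {b i} hyp inc))

-- The kernel of a nonzero functional is a hyperplane.

punchIn-cover : ∀ {k} {P : Pred (Fin (suc k)) p} j → P j → (∀ i → P (punchIn j i)) → ∀ i → P i
punchIn-cover {P = P} j Pj P-rest i with j Fin.≟ i
... | yes ≡.refl = Pj
... | no j≢i = ≡.subst P (Fin.punchIn-punchOut j≢i) (P-rest (punchOut j≢i))

module CoordinateFunctional {F : Field 0ℓ 0ℓ} {q : ℕ} (F# : HasOrder F q) (k : ℕ) where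
  open Field F hiding (zero)
  open FieldProperties F
  open FiniteField {F = F} F# using (_≟_)
  open FiniteVectorSpace {F = F} F# (suc k)
  open LeftModule V
  open LinearAlgebra V
  open Sum +-commutativeMonoid using (sum; sum-cong-≋)

  lookup-linearCombination : ∀ {l} a (b : Vector Carrierᴹ l) i →
                             linearCombination a b i ≈ sum (λ j → a j * b j i)
  lookup-linearCombination {zero}  a b i = refl
  lookup-linearCombination {suc l} a b i = +-congˡ (lookup-linearCombination (a ∘ suc) (b ∘ suc) i)

  δ : ∀ {l} → Fin l → Vector Carrier l
  δ i j with i Fin.≟ j
  ... | yes _ = 1#
  ... | no  _ = 0#

  δ-diagonal : ∀ {l} (i : Fin l) → δ i i ≈ 1#
  δ-diagonal i with i Fin.≟ i
  ... | yes _  = refl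
  ... | no i≢i = contradiction ≡.refl i≢i

  δ-off-diagonal : ∀ {l} {i j : Fin l} → i ≢ j → δ i j ≈ 0#
  δ-off-diagonal {i = i} {j} i≢j with i Fin.≟ j
  ... | yes i≡j = contradiction i≡j i≢j
  ... | no _    = refl

  sum-δ : ∀ {l} (a : Vector Carrier l) i → sum (λ j → a j * δ j i) ≈ a i
  sum-δ a i = trans
    (sum-single +-commutativeMonoid (λ j → a j * δ j i) i
      (λ j j≢i → trans (*-congˡ (δ-off-diagonal j≢i)) (zeroʳ _)))
    (trans (*-congˡ (δ-diagonal i)) (*-identityʳ _))

  module _ (m : Functional) {y} (my≉0 : Functional.to m y ≉ 0#) where
    open Functional m

    pivot : ∃[ j ] to (δ j) ≉ 0#
    pivot with Fin.any? (λ j → ¬? (to (δ j) ≟ 0#))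
    ... | yes found = found
    ... | no ∄ = contradiction
      (trans (cong (λ i → sym (trans (lookup-linearCombination y δ i) (sum-δ y i))))
             (to-linearCombination y δ (λ j → decidable-stable (to (δ j) ≟ 0#) (λ mδ≉0 → ∄ (j , mδ≉0)))))
      my≉0

    private
      j = proj₁ pivot

    -- Such an x is a multiple of `δ j`, where the functional does not vanish. So deleting the pivot
    -- coordinate is injective on the kernel.
    kernel-determined : ∀ {x} → to x ≈ 0# → (∀ i → x (punchIn j i) ≈ 0#) → x ≈ᴹ 0ᴹ
    kernel-determined {x} mx≈0 x≈0-off = punchIn-cover j xⱼ≈0 x≈0-off
      where
      x≈xⱼδ : x ≈ᴹ x j *ₗ δ j
      x≈xⱼδ = punchIn-cover j
        (sym (trans (*-congˡ (δ-diagonal j)) (*-identityʳ _)))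
        (λ i → trans (x≈0-off i)
          (sym (trans (*-congˡ (δ-off-diagonal (Fin.punchInᵢ≢i j i ∘ ≡.sym))) (zeroʳ _))))

      xⱼ≈0 : x j ≈ 0#
      xⱼ≈0 = decidable-stable (x j ≟ 0#) λ xⱼ≉0 → proj₂ pivot
        (unscale-closed kernel xⱼ≉0 (trans (sym (cong x≈xⱼδ)) mx≈0))

    -- Each unit vector away from the pivot is corrected by the multiple `r i` of `δ j` that brings
    -- it into the kernel. Deleting the pivot coordinate turns these vectors into the standard
    -- basis, so the coefficients of a kernel vector are its remaining coordinates.
    kernel-dimension : HasDimension kernel k
    kernel-dimension = b , record
      { members     = b∈kernel
      ; independent = λ a ab≈0 i → trans (sym (coordinate a i)) (ab≈0 (punchIn j i))
      ; spanning    = λ {w} w∈ker → let a = λ i → w (punchIn j i) in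
          a , u-v≈0⇒u≈v (kernel-determined
            (+-closed w∈ker (*ₗ-closed (- 1#) (linearCombination-closed kernel a b b∈kernel)))
            (λ i → trans (+-congˡ (*-congˡ (coordinate a i)))
                         (trans (+-congˡ (RingProperties.-1*x≈-x ring _)) (-‿inverseʳ _))))
      }
      where
      open Subspace kernel
      c = proj₁ (leftInverse (proj₂ pivot))

      r : Fin k → Carrier
      r i = - (to (insertAt (δ i) j 0#) * c)

      b : Vector Carrierᴹ k
      b i = insertAt (δ i) j (r i)

      b-split : ∀ i → b i ≈ᴹ insertAt (δ i) j 0# +ᴹ r i *ₗ δ j
      b-split i = punchIn-cover j
        (trans (reflexive (insertAt-lookup (δ i) j (r i))) (sym (trans
          (+-cong (reflexive (insertAt-lookup (δ i) j 0#)) (trans (*-congˡ (δ-diagonal j)) (*-identityʳ _)))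
          (+-identityˡ _))))
        (λ l → trans (reflexive (insertAt-punchIn (δ i) j (r i) l)) (sym (trans
          (+-cong (reflexive (insertAt-punchIn (δ i) j 0# l))
                  (trans (*-congˡ (δ-off-diagonal (Fin.punchInᵢ≢i j l ∘ ≡.sym))) (zeroʳ _)))
          (+-identityʳ _))))

      b∈kernel : ∀ i → to (b i) ≈ 0#
      b∈kernel i = let z = to (insertAt (δ i) j 0#) in
        trans (cong (b-split i)) (trans (+-homo _ _) (trans
          (+-congˡ (trans (*-homo _ _) (trans (sym (RingProperties.-‿distribˡ-* ring _ _))
            (-‿cong (trans (*-assoc z c _) (trans (*-congˡ (proj₂ (leftInverse (proj₂ pivot)))) (*-identityʳ z)))))))
          (-‿inverseʳ z)))

      coordinate : ∀ a i → linearCombination a b (punchIn j i) ≈ a i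
      coordinate a i = trans (lookup-linearCombination a b (punchIn j i))
        (trans (sum-cong-≋ (λ l → *-congˡ (reflexive (insertAt-punchIn (δ l) j (r l) i)))) (sum-δ a i))

-- Linear sets and their intersections with subspaces.

module LinearSet (K F : Field 0ℓ 0ℓ) {p q : ℕ} (K# : HasOrder K p) (F# : HasOrder F q)
                 (p<q : p < q) {ι : Field.Carrier K → Field.Carrier F}
                 (ι-hom : IsRingHomomorphism (Field.rawRing K) (Field.rawRing F) ι)
                 (n d : ℕ) (pᵈ≡pqⁿ : p ^ d ≡ p ℕ.* q ^ n) where
  open Field F hiding (zero)
  open FieldProperties F
  open FiniteField {F = F} F#
  open FiniteVectorSpace {F = F} F# (suc (suc n)) hiding (V)
  open ProjectiveSpace F (suc n)
  open FieldReduction K F ι-hom (suc n)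
  open HyperplaneCode K F (suc n) using (Word; _IsIncidenceVectorOf_; C)
  open LeftModule V
  open LinearAlgebra V
  open +-*-Solver using (solve; con; _:=_; _:*_)
  module K where
    open Field K public
    open FieldProperties K public
    open FiniteField {F = K} K# public
  module Kᵈ where
    open LeftModule (coordinateModule K.ring d) public
    open LinearAlgebra (coordinateModule K.ring d) public using (Subspace)
    open FiniteVectorSpace {F = K} K# d public hiding (V)
  module Vᴷ where
    open LinearAlgebra Vᴷ public
    open LinearCombination Vᴷ public
  module ι = IsRingHomomorphism ι-hom

  1<p : 1 < p
  1<p = K.1<q

  instance
    p≢0 : ℕ.NonZero p
    p≢0 = ℕ.>-nonZero (ℕ.<-trans (ℕ.s≤s ℕ.z≤n) 1<p)

    q≢0 : ℕ.NonZero q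
    q≢0 = ℕ.>-nonZero (ℕ.<-trans (ℕ.s≤s ℕ.z≤n) 1<q)

  2<q : 2 < q
  2<q = ℕ.≤-<-trans 1<p p<q

  ι≉0 : ∀ {s} → s K.≉ K.0# → ι s ≉ 0#
  ι≉0 {s} s≉0 ιs≈0 = let (t , ts≈1) = K.leftInverse s≉0 in 1≉0 (trans
    (trans (sym ι.1#-homo) (trans (ι.⟦⟧-cong (K.sym ts≈1)) (ι.*-homo t s)))
    (trans (*-congˡ ιs≈0) (zeroʳ _)))

  -- The span of b is U, so that Covered x below says that ⟨x⟩ belongs to 𝓑(U).
  module _ (b : Vector Carrierᴹ d) (b-independent : Vᴷ.LinearlyIndependent b) where

    embed : Kᵈ.Carrierᴹ → Carrierᴹ
    embed a = Vᴷ.linearCombination a b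

    embed-cong : ∀ {a a′} → a Kᵈ.≈ᴹ a′ → embed a ≈ᴹ embed a′
    embed-cong a≈a′ = Vᴷ.linearCombination-cong {b = b} {b′ = b} a≈a′ (λ _ → ≈ᴹ-refl)

    embed-homo : ∀ a s a′ → embed (a Kᵈ.+ᴹ s Kᵈ.*ₗ a′) ≈ᴹ embed a +ᴹ ι s *ₗ embed a′
    embed-homo a s a′ = Vᴷ.linearCombination-homo a s a′ b

    embed-0 : embed Kᵈ.0ᴹ ≈ᴹ 0ᴹ
    embed-0 = Vᴷ.linearCombination-zero b (λ _ → K.refl)

    embed-* : ∀ s a → embed (s Kᵈ.*ₗ a) ≈ᴹ ι s *ₗ embed a
    embed-* s a = ≈ᴹ-trans (embed-cong (Kᵈ.≈ᴹ-sym (Kᵈ.+ᴹ-identityˡ _)))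
      (≈ᴹ-trans (embed-homo Kᵈ.0ᴹ s a) (≈ᴹ-trans (+ᴹ-congʳ embed-0) (+ᴹ-identityˡ _)))

    embed-+ : ∀ a a′ → embed (a Kᵈ.+ᴹ a′) ≈ᴹ embed a +ᴹ embed a′
    embed-+ a a′ = ≈ᴹ-trans (embed-cong (Kᵈ.+ᴹ-congˡ {a} (Kᵈ.≈ᴹ-sym (Kᵈ.*ₗ-identityˡ a′))))
      (≈ᴹ-trans (embed-homo a K.1# a′)
        (+ᴹ-congˡ (≈ᴹ-trans (*ₗ-congʳ ι.1#-homo) (*ₗ-identityˡ _))))

    embed-nonzero : ∀ {a} → ¬ a Kᵈ.≈ᴹ Kᵈ.0ᴹ → ¬ embed a ≈ᴹ 0ᴹ
    embed-nonzero a≉0 ab≈0 = a≉0 (b-independent _ ab≈0)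

    -- A K-linear map from Kᵈ × Fˡ to Fʳ with a larger domain has a kernel. The selection `σ` is
    -- `id` for relations in the whole space, and omits the pivot coordinate for vectors in the
    -- kernel of a functional, where the remaining coordinates suffice.
    mixed-dependence : ∀ {l r} (vs : Vector Carrierᴹ l) (σ : Fin r → Fin (suc (suc n))) →
      q ^ r < p ^ d ℕ.* q ^ l →
      ∃₂ λ a (c : Vector Carrier l) → ¬ (a Kᵈ.≈ᴹ Kᵈ.0ᴹ × ∀ i → c i ≈ 0#) ×
        (∀ i → (embed a +ᴹ linearCombination c vs) (σ i) ≈ 0#)
    mixed-dependence {l} {r} vs σ #< = let
        ((a , c) , ac≉0 , eq) = nontrivialKernel {F = K} K._≟_
          (coordinateModule K.ring d ×ᴹ restrictScalars {R = K.ring} {S = ring} ι-hom (coordinateModule ring l))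
          (restrictScalars {R = K.ring} {S = ring} ι-hom (coordinateModule ring r))
          (×-size (K.coordinates# d) (coordinates# l)) (coordinates# r) #<
          (λ (a , c) i → (embed a +ᴹ linearCombination c vs) (σ i))
          (λ (a , c) s (a′ , c′) i → homo a c s a′ c′ (σ i))
      in a , c , ac≉0 , eq
      where
      homo : ∀ a c s a′ c′ →
        embed (a Kᵈ.+ᴹ s Kᵈ.*ₗ a′) +ᴹ linearCombination (λ i → c i + ι s * c′ i) vs
          ≈ᴹ (embed a +ᴹ linearCombination c vs) +ᴹ ι s *ₗ (embed a′ +ᴹ linearCombination c′ vs)
      homo a c s a′ c′ = ≈ᴹ-trans
        (+ᴹ-cong (embed-homo a s a′) (linearCombination-homo c (ι s) c′ vs))
        (≈ᴹ-trans (+ᴹ-interchange _ _ _ _) (+ᴹ-congˡ (≈ᴹ-sym (*ₗ-distribˡ (ι s) _ _))))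

    Covered : Carrierᴹ → Set
    Covered x = ∃₂ λ a μ → ¬ a Kᵈ.≈ᴹ Kᵈ.0ᴹ × embed a ≈ᴹ μ *ₗ x

    covered? : ∀ x → Dec (Covered x)
    covered? x = map′ (λ ((a , μ) , r) → a , μ , r) (λ (a , μ , r) → (a , μ) , r)
      (Enumeration.search (×-size (K.coordinates# d) F#)
        (λ { (a≈a′ , μ≈μ′) (a≉0 , eq) → (λ a′≈0 → a≉0 (Kᵈ.≈ᴹ-trans a≈a′ a′≈0))
                                      , ≈ᴹ-trans (embed-cong (Kᵈ.≈ᴹ-sym a≈a′)) (≈ᴹ-trans eq (*ₗ-congʳ μ≈μ′)) })
        (λ (a , μ) → ¬? (a Kᵈ.≟ᴹ Kᵈ.0ᴹ) ×-dec (embed a ≟ᴹ μ *ₗ x)))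

    covered-scalar≉0 : ∀ {a μ x} → ¬ a Kᵈ.≈ᴹ Kᵈ.0ᴹ → embed a ≈ᴹ μ *ₗ x → μ ≉ 0#
    covered-scalar≉0 a≉0 ab≈μx μ≈0 =
      embed-nonzero a≉0 (≈ᴹ-trans ab≈μx (≈ᴹ-trans (*ₗ-congʳ μ≈0) (*ₗ-zeroˡ _)))

    -- Otherwise each x would be determined by a pair (μ, a) with μ x = `embed a` and μ ≠ 0, the
    -- zero vector by (1, 0). But there are only q p^d = p qⁿ⁺¹ pairs for qⁿ⁺² vectors.
    not-all-covered : ¬ (∀ x → ¬ x ≈ᴹ 0ᴹ → Covered x)
    not-all-covered all = ℕ.<⇒≱ small
      (injection⇒≤ (coordinates# (suc (suc n))) (×-size F# (K.coordinates# d)) code code-injective)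
      where
      small : q ℕ.* p ^ d < q ^ suc (suc n)
      small rewrite pᵈ≡pqⁿ = ℕ.*-monoʳ-< q (ℕ.*-monoˡ-< (q ^ n) ⦃ ℕ.m^n≢0 q n ⦄ p<q)

      represent : ∀ x → ∃₂ λ μ a → μ ≉ 0# × embed a ≈ᴹ μ *ₗ x
      represent x with x ≟ᴹ 0ᴹ
      ... | yes x≈0 = 1# , Kᵈ.0ᴹ , 1≉0 , ≈ᴹ-trans embed-0 (≈ᴹ-sym (≈ᴹ-trans (*ₗ-identityˡ x) x≈0))
      ... | no x≉0 = let (a , μ , a≉0 , eq) = all x x≉0 in μ , a , covered-scalar≉0 {x = x} a≉0 eq , eq

      code : Carrierᴹ → Carrier × Kᵈ.Carrierᴹ
      code x = let (μ , a , _) = represent x in μ , a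

      code-injective : ∀ {x y} → (proj₁ (code x) ≈ proj₁ (code y)) × (proj₂ (code x) Kᵈ.≈ᴹ proj₂ (code y)) → x ≈ᴹ y
      code-injective {x} {y} (μ≈ν , a≈a′) = let
          (μ , a , μ≉0 , eq) = represent x
          (ν , a′ , _ , eq′) = represent y
        in *ₗ-cancelˡ μ≉0 (≈ᴹ-trans (≈ᴹ-sym eq) (≈ᴹ-trans (embed-cong a≈a′)
             (≈ᴹ-trans eq′ (*ₗ-congʳ (sym μ≈ν)))))

    -- Tangent lines through a point e outside the linear set.

    module Centre {e : Carrierᴹ} (e≉0 : ¬ e ≈ᴹ 0ᴹ) (e-uncovered : ¬ Covered e) where
      open Moment K F F# 2<q ι-hom n e

      coefficients≈0 : ∀ {x s t} → OffCentre x → s *ₗ e +ᴹ t *ₗ x ≈ᴹ 0ᴹ → s ≈ 0# × t ≈ 0#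
      coefficients≈0 {x} {s} {t} off eq = s≈0 , t≈0
        where
        t≈0 : t ≈ 0#
        t≈0 = decidable-stable (t ≟ 0#) λ t≉0 → let (u , ut≈1) = leftInverse t≉0 in
          off (u * s) (≈ᴹ-trans
            (+ᴹ-cong (≈ᴹ-sym (*ₗ-unscale ut≈1 x)) (*ₗ-assoc u s e))
            (≈ᴹ-trans (≈ᴹ-sym (*ₗ-distribˡ u _ _))
              (≈ᴹ-trans (*ₗ-congˡ (≈ᴹ-trans (+ᴹ-comm _ _) eq)) (*ₗ-zeroʳ u))))

        s≈0 : s ≈ 0#
        s≈0 = *ₗ≈0⇒≈0 e≉0 (≈ᴹ-trans (≈ᴹ-sym (≈ᴹ-trans
          (+ᴹ-congˡ (≈ᴹ-trans (*ₗ-congʳ t≈0) (*ₗ-zeroˡ x))) (+ᴹ-identityʳ _))) eq)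

      plane : Carrierᴹ → Subspace 0ℓ
      plane x = record
        { Member    = λ y → ∃₂ λ α β → y ≈ᴹ α *ₗ e +ᴹ β *ₗ x
        ; resp      = λ y≈z (α , β , eq) → α , β , ≈ᴹ-trans (≈ᴹ-sym y≈z) eq
        ; 0-closed  = 0# , 0# , ≈ᴹ-sym (≈ᴹ-trans (+ᴹ-cong (*ₗ-zeroˡ e) (*ₗ-zeroˡ x)) (+ᴹ-identityˡ 0ᴹ))
        ; +-closed  = λ (α , β , eq) (α′ , β′ , eq′) → α + α′ , β + β′ ,
            ≈ᴹ-trans (+ᴹ-cong eq eq′) (≈ᴹ-trans (+ᴹ-interchange _ _ _ _)
              (+ᴹ-cong (≈ᴹ-sym (*ₗ-distribʳ e α α′)) (≈ᴹ-sym (*ₗ-distribʳ x β β′))))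
        ; *ₗ-closed = λ s (α , β , eq) → s * α , s * β ,
            ≈ᴹ-trans (*ₗ-congˡ eq) (≈ᴹ-trans (*ₗ-distribˡ s _ _)
              (+ᴹ-cong (≈ᴹ-sym (*ₗ-assoc s α e)) (≈ᴹ-sym (*ₗ-assoc s β x))))
        }

      open Subspace using (Member)

      plane? : ∀ x y → Dec (y ∈ Member (plane x))
      plane? x y = map′ (λ ((α , β) , eq) → α , β , eq) (λ (α , β , eq) → (α , β) , eq)
        (Enumeration.search (×-size F# F#)
          (λ (α≈ , β≈) eq → ≈ᴹ-trans eq (+ᴹ-cong (*ₗ-congʳ α≈) (*ₗ-congʳ β≈)))
          (λ (α , β) → y ≟ᴹ α *ₗ e +ᴹ β *ₗ x))

      second-coefficient≉0 : ∀ {a α β x} → ¬ a Kᵈ.≈ᴹ Kᵈ.0ᴹ → embed a ≈ᴹ α *ₗ e +ᴹ β *ₗ x → β ≉ 0#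
      second-coefficient≉0 {x = x} a≉0 eq β≈0 = e-uncovered (_ , _ , a≉0 , ≈ᴹ-trans eq
        (≈ᴹ-trans (+ᴹ-congˡ (≈ᴹ-trans (*ₗ-congʳ β≈0) (*ₗ-zeroˡ x))) (+ᴹ-identityʳ _)))

      -- U and the plane are too large to be independent over K: p^d q² = p qⁿ⁺² exceeds the number
      -- qⁿ⁺² of all vectors. In the relation found, a = 0 is excluded because e and x are
      -- independent.
      meets-plane : ∀ {x} → OffCentre x → ∃[ a ] ¬ a Kᵈ.≈ᴹ Kᵈ.0ᴹ × embed a ∈ Member (plane x)
      meets-plane {x} off with mixed-dependence (e ∷ x ∷ []) id large
        where
        large : q ^ suc (suc n) < p ^ d ℕ.* q ^ 2
        large rewrite pᵈ≡pqⁿ = ≡.subst (q ^ suc (suc n) <_)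
          (solve 3 (λ p q Q → q :* (q :* Q) :* p := p :* Q :* (q :* (q :* con 1))) ≡.refl p q (q ^ n))
          (ℕ.m<m*n (q ^ suc (suc n)) p ⦃ ℕ.m^n≢0 q (suc (suc n)) ⦄ 1<p)
      ... | a , c , ac≉0 , eq = a , a≉0 , resp (≈ᴹ-sym (u+v≈0⇒u≈-v eq)) (*ₗ-closed (- 1#)
          (c zero , c (suc zero) , +ᴹ-congˡ (+ᴹ-identityʳ _)))
        where
        open Subspace (plane x) hiding (Member)
        a≉0 : ¬ a Kᵈ.≈ᴹ Kᵈ.0ᴹ
        a≉0 a≈0 = let
            ab≈0 = ≈ᴹ-trans (embed-cong a≈0) embed-0
            (c₀≈0 , c₁≈0) = coefficients≈0 {x} off (≈ᴹ-trans (≈ᴹ-sym (+ᴹ-congˡ (+ᴹ-identityʳ _)))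
              (≈ᴹ-trans (≈ᴹ-sym (≈ᴹ-trans (+ᴹ-congʳ ab≈0) (+ᴹ-identityˡ _))) eq))
          in ac≉0 (a≈0 , λ { zero → c₀≈0 ; (suc zero) → c₁≈0 })

      module _ (ψ : Kᵈ.Functional) {a*} (ψa*≉0 : Kᵈ.Functional.to ψ a* K.≉ K.0#) where
        private
          module ψ = Kᵈ.Functional ψ

        -- With U₀ the image of the kernel of ψ under `embed`, this says for x off the centre that
        -- the line through e and x meets 𝓑(U₀).
        MeetsKernel : Carrierᴹ → Set
        MeetsKernel x = ∃[ a ] ¬ a Kᵈ.≈ᴹ Kᵈ.0ᴹ × ψ.to a K.≈ K.0# × embed a ∈ Member (plane x)

        meetsKernel? : ∀ x → Dec (MeetsKernel x)
        meetsKernel? x = Kᵈ.searchᴹ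
          (λ a≈a′ (a≉0 , ψa≈0 , a∈) → (λ a′≈0 → a≉0 (Kᵈ.≈ᴹ-trans a≈a′ a′≈0))
            , K.trans (ψ.cong (Kᵈ.≈ᴹ-sym a≈a′)) ψa≈0 , Subspace.resp (plane x) (embed-cong a≈a′) a∈)
          (λ a → ¬? (a Kᵈ.≟ᴹ Kᵈ.0ᴹ) ×-dec ((ψ.to a K.≟ K.0#) ×-dec plane? x (embed a)))

        -- Otherwise (x , s) ↦ (μ , t , a + s a*), where μ x + t e = embed a with ψ a = 0
        -- and μ ≠ 0, would embed V × K into F* × F × Kᵈ.
        some-plane-missed : ¬ (∀ x → OffCentre x → MeetsKernel x)
        -- Domain and codomain of `code` have the same size p qⁿ⁺², so strictness is the
        -- contradiction. It comes from (0, 0, 0), which is missed because μ is never zero.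
        some-plane-missed all = ℕ.<⇒≢ #<
          (≡.trans (solve 3 (λ p q Q → q :* (q :* Q) :* p := q :* (q :* (p :* Q))) ≡.refl p q (q ^ n))
                   (≡.cong (λ m → q ℕ.* (q ℕ.* m)) (≡.sym pᵈ≡pqⁿ)))
          where
          represent : ∀ x → ∃[ μ ] ∃₂ λ t a → μ ≉ 0# × ψ.to a K.≈ K.0# × μ *ₗ x +ᴹ t *ₗ e ≈ᴹ embed a
          represent x with search {P = λ t → x +ᴹ t *ₗ e ≈ᴹ 0ᴹ}
                             (λ s≈t eq → ≈ᴹ-trans (+ᴹ-congˡ (*ₗ-congʳ (sym s≈t))) eq)
                             (λ t → x +ᴹ t *ₗ e ≟ᴹ 0ᴹ)
          ... | yes (t , eq) = 1# , t , Kᵈ.0ᴹ , 1≉0 , ψ.0-homo ,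
            ≈ᴹ-trans (+ᴹ-congʳ (*ₗ-identityˡ x)) (≈ᴹ-trans eq (≈ᴹ-sym embed-0))
          ... | no ∄ = let (a , a≉0 , ψa≈0 , α , β , eq) = all x (λ t eq → ∄ (t , eq)) in
            β , α , a , second-coefficient≉0 {x = x} a≉0 eq , ψa≈0 , ≈ᴹ-trans (+ᴹ-comm _ _) (≈ᴹ-sym eq)

          code : Carrierᴹ × K.Carrier → Carrier × Carrier × Kᵈ.Carrierᴹ
          code (x , s) = let (μ , t , a , _) = represent x in μ , t , a Kᵈ.+ᴹ s Kᵈ.*ₗ a*

          code-injective : ∀ {xs yt} →
            (proj₁ (code xs) ≈ proj₁ (code yt)) × (proj₁ (proj₂ (code xs)) ≈ proj₁ (proj₂ (code yt)))
              × (proj₂ (proj₂ (code xs)) Kᵈ.≈ᴹ proj₂ (proj₂ (code yt))) →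
            (proj₁ xs ≈ᴹ proj₁ yt) × (proj₂ xs K.≈ proj₂ yt)
          code-injective {x , s} {x′ , s′} (μ≈μ′ , t≈t′ , eq) = let
              (μ , t , a , μ≉0 , ψa≈0 , rep) = represent x
              (μ′ , t′ , a′ , _ , ψa′≈0 , rep′) = represent x′
              -- Applying ψ to a + s a* kills a and thus recovers s; subtracting s a* then recovers
              -- a, and μ and t give back x.
              ψ-code : ∀ {a} s → ψ.to a K.≈ K.0# → ψ.to (a Kᵈ.+ᴹ s Kᵈ.*ₗ a*) K.≈ s K.* ψ.to a*
              ψ-code s ψa≈0 = K.trans (ψ.+-homo _ _)
                (K.trans (K.+-cong ψa≈0 (ψ.*-homo s a*)) (K.+-identityˡ _))
              (r , _ , ψa*r≈1) = K.inverse ψa*≉0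
              recover : ∀ s → (s K.* ψ.to a*) K.* r K.≈ s
              recover s = K.trans (K.*-assoc s _ r) (K.trans (K.*-congˡ ψa*r≈1) (K.*-identityʳ s))
              s≈s′ = K.trans (K.sym (recover s)) (K.trans
                (K.*-congʳ (K.trans (K.sym (ψ-code s ψa≈0)) (K.trans (ψ.cong eq) (ψ-code s′ ψa′≈0))))
                (recover s′))
              a≈a′ = Kᵈ.+ᴹ-cancelʳ _ a a′ (Kᵈ.≈ᴹ-trans eq (Kᵈ.+ᴹ-congˡ (Kᵈ.*ₗ-congʳ (K.sym s≈s′))))
            in *ₗ-cancelˡ μ≉0 (+ᴹ-cancelʳ (t *ₗ e) _ _ (≈ᴹ-trans rep (≈ᴹ-trans (embed-cong a≈a′)
                 (≈ᴹ-trans (≈ᴹ-sym rep′) (+ᴹ-cong (*ₗ-congʳ (sym μ≈μ′)) (*ₗ-congʳ (sym t≈t′)))))))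
             , s≈s′

          #< : q ^ suc (suc n) ℕ.* p < q ℕ.* (q ℕ.* p ^ d)
          #< = non-surjective-injection⇒< (×-size (coordinates# (suc (suc n))) K#)
            (×-size F# (×-size F# (K.coordinates# d))) code code-injective (0# , 0# , Kᵈ.0ᴹ)
            (λ (x , s) (μ≈0 , _) → proj₁ (proj₂ (proj₂ (proj₂ (represent x)))) μ≈0)

        module Tangent {x} (x-off : OffCentre x) (missed : ¬ MeetsKernel x) where
          a : Kᵈ.Carrierᴹ
          a = proj₁ (meets-plane x-off)

          a≉0 : ¬ a Kᵈ.≈ᴹ Kᵈ.0ᴹ
          a≉0 = proj₁ (proj₂ (meets-plane x-off))

          a∈plane : embed a ∈ Member (plane x)
          a∈plane = proj₂ (proj₂ (meets-plane x-off))

          private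
            α = proj₁ a∈plane
            β = proj₁ (proj₂ a∈plane)
            β≉0 = second-coefficient≉0 {x = x} a≉0 (proj₂ (proj₂ a∈plane))
            γ = proj₁ (inverse β≉0)
            γβ≈1 = proj₁ (proj₂ (inverse β≉0))
            βγ≈1 = proj₂ (proj₂ (inverse β≉0))

          ψa≉0 : ψ.to a K.≉ K.0#
          ψa≉0 ψa≈0 = missed (a , a≉0 , ψa≈0 , a∈plane)

          y : Carrierᴹ
          y = γ *ₗ embed a

          a≈βy : embed a ≈ᴹ β *ₗ y
          a≈βy = ≈ᴹ-sym (*ₗ-unscale βγ≈1 (embed a))

          y≈x+ : y ≈ᴹ x +ᴹ (γ * α) *ₗ e
          y≈x+ = ≈ᴹ-trans (*ₗ-congˡ (proj₂ (proj₂ a∈plane))) (≈ᴹ-trans (*ₗ-distribˡ γ _ _)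
            (≈ᴹ-trans (+ᴹ-comm _ _) (+ᴹ-cong (*ₗ-unscale γβ≈1 x) (≈ᴹ-sym (*ₗ-assoc γ α e)))))

          shift : ∀ {x y s} → y ≈ᴹ x +ᴹ s *ₗ e → ∀ t → y +ᴹ t *ₗ e ≈ᴹ x +ᴹ (s + t) *ₗ e
          shift y≈ t = ≈ᴹ-trans (+ᴹ-congʳ y≈) (≈ᴹ-trans (+ᴹ-assoc _ _ _) (+ᴹ-congˡ (≈ᴹ-sym (*ₗ-distribʳ e _ t))))

          shift-off : ∀ {x y s} → y ≈ᴹ x +ᴹ s *ₗ e → OffCentre x → OffCentre y
          shift-off y≈ off t eq = off _ (≈ᴹ-trans (≈ᴹ-sym (shift y≈ t)) eq)

          y-off : OffCentre y
          y-off = shift-off y≈x+ x-off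

          -- The combination c = ψ(a′) a - ψ(a) a′ lies in the kernel of ψ and its image lies in the
          -- plane, which misses that kernel, so c = 0. Written in e and y, the relation `embed c` =
          -- 0 has e-coefficient t times a nonzero scalar.
          tangent : ∀ {t} → Covered (y +ᴹ t *ₗ e) → t ≈ 0#
          tangent {t} (a′ , μ , a′≉0 , a′≈μ) = decidable-stable (t ≟ 0#) λ t≉0 →
            *-nonzero t≉0 (*-nonzero μ≉0 (ι≉0 (-‿nonzero ψa≉0)))
              (proj₁ (coefficients≈0 {y} y-off combination≈0))
            where
            *-nonzero : ∀ {s t} → s ≉ 0# → t ≉ 0# → s * t ≉ 0#
            *-nonzero {s} {t} s≉0 t≉0 st≈0 = let (r , rs≈1) = leftInverse s≉0 in t≉0 (trans
              (sym (trans (sym (*-assoc r s t)) (trans (*-congʳ rs≈1) (*-identityˡ t))))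
              (trans (*-congˡ st≈0) (zeroʳ r)))

            -‿nonzero : ∀ {s} → s K.≉ K.0# → K.- s K.≉ K.0#
            -‿nonzero {s} s≉0 -s≈0 = s≉0 (K.trans (K.sym (K.+-identityʳ s))
              (K.trans (K.+-congˡ (K.sym -s≈0)) (K.-‿inverseʳ s)))

            μ≉0 = covered-scalar≉0 {x = y +ᴹ t *ₗ e} a′≉0 a′≈μ

            s = ι (K.- ψ.to a)

            c : Kᵈ.Carrierᴹ
            c = ψ.to a′ Kᵈ.*ₗ a Kᵈ.+ᴹ (K.- ψ.to a) Kᵈ.*ₗ a′

            ψc≈0 : ψ.to c K.≈ K.0#
            ψc≈0 = K.trans (ψ.combination-homo _ _ _ _) (K.trans
              (K.+-cong (K.*-comm _ _) (K.sym (RingProperties.-‿distribˡ-* K.ring _ _)))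
              (K.-‿inverseʳ _))

            embed-c : embed c ≈ᴹ ι (ψ.to a′) *ₗ embed a +ᴹ s *ₗ embed a′
            embed-c = ≈ᴹ-trans (embed-homo _ _ _) (+ᴹ-congʳ (embed-* _ _))

            c∈plane : embed c ∈ Member (plane x)
            c∈plane = resp (≈ᴹ-sym embed-c)
              (+-closed (*ₗ-closed _ a∈plane) (*ₗ-closed _ (resp (≈ᴹ-sym a′≈μ) (*ₗ-closed μ
                (resp (≈ᴹ-sym (shift y≈x+ t)) (γ * α + t , 1# ,
                  ≈ᴹ-trans (+ᴹ-comm _ _) (+ᴹ-congˡ (≈ᴹ-sym (*ₗ-identityˡ x)))))))))
              where open Subspace (plane x)

            c≈0 : c Kᵈ.≈ᴹ Kᵈ.0ᴹ
            c≈0 = decidable-stable (c Kᵈ.≟ᴹ Kᵈ.0ᴹ) λ c≉0 → missed (c , c≉0 , ψc≈0 , c∈plane)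

            combination≈0 : (t * (μ * s)) *ₗ e +ᴹ (ι (ψ.to a′) * β + μ * s) *ₗ y ≈ᴹ 0ᴹ
            combination≈0 = begin
              (t * (μ * s)) *ₗ e +ᴹ (ι (ψ.to a′) * β + μ * s) *ₗ y
                ≈⟨ +ᴹ-cong (*ₗ-congʳ (*-comm t _)) (*ₗ-distribʳ y _ _) ⟩
              (μ * s * t) *ₗ e +ᴹ ((ι (ψ.to a′) * β) *ₗ y +ᴹ (μ * s) *ₗ y)
                ≈⟨ +ᴹ-comm _ _ ⟩
              ((ι (ψ.to a′) * β) *ₗ y +ᴹ (μ * s) *ₗ y) +ᴹ (μ * s * t) *ₗ e
                ≈⟨ +ᴹ-assoc _ _ _ ⟩
              (ι (ψ.to a′) * β) *ₗ y +ᴹ ((μ * s) *ₗ y +ᴹ (μ * s * t) *ₗ e)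
                ≈⟨ +ᴹ-cong (*ₗ-assoc _ β y) (+ᴹ-congˡ (*ₗ-assoc _ t e)) ⟩
              ι (ψ.to a′) *ₗ (β *ₗ y) +ᴹ ((μ * s) *ₗ y +ᴹ (μ * s) *ₗ (t *ₗ e))
                ≈⟨ +ᴹ-cong (*ₗ-congˡ a≈βy) (*ₗ-distribˡ _ _ _) ⟨
              ι (ψ.to a′) *ₗ embed a +ᴹ (μ * s) *ₗ (y +ᴹ t *ₗ e)
                ≈⟨ +ᴹ-congˡ (*ₗ-congʳ (*-comm μ s)) ⟩
              ι (ψ.to a′) *ₗ embed a +ᴹ (s * μ) *ₗ (y +ᴹ t *ₗ e)
                ≈⟨ +ᴹ-congˡ (*ₗ-assoc s μ _) ⟩
              ι (ψ.to a′) *ₗ embed a +ᴹ s *ₗ (μ *ₗ (y +ᴹ t *ₗ e))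
                ≈⟨ +ᴹ-congˡ (*ₗ-congˡ a′≈μ) ⟨
              ι (ψ.to a′) *ₗ embed a +ᴹ s *ₗ embed a′
                ≈⟨ embed-c ⟨
              embed c
                ≈⟨ embed-cong c≈0 ⟩
              embed Kᵈ.0ᴹ
                ≈⟨ embed-0 ⟩
              0ᴹ ∎
              where open ≈-Reasoning ≈ᴹ-setoid

          module _ {S : Pred Point 0ℓ} (S⊆Covered : ∀ {P} → P ∈ S → Covered (Point.coords P))
                   (Covered⊆S : ∀ {P} → Covered (Point.coords P) → P ∈ S)
                   {v : Word} (v-inc : v IsIncidenceVectorOf S)
                   (m : Functional) (m-moment : ∀ x x-off → moment v x x-off ≈ Functional.to m x) where
            private
              module m = Functional m

            my≈0 : m.to y ≈ 0#
            my≈0 = trans (sym (m-moment y y-off)) (moment-tangent {S} {v} v-inc y-off 0#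
              (λ P∈S → tangent (S⊆Covered P∈S))
              (λ t≈0 → Covered⊆S (a , β , a≉0 , ≈ᴹ-trans a≈βy (*ₗ-congˡ (≈ᴹ-sym
                (≈ᴹ-trans (+ᴹ-congˡ (≈ᴹ-trans (*ₗ-congʳ t≈0) (*ₗ-zeroˡ e))) (+ᴹ-identityʳ y)))))))

            embed-a∈kernel : m.to (embed a) ≈ 0#
            embed-a∈kernel = trans (m.cong a≈βy) (trans (m.*-homo β y) (trans (*-congˡ my≈0) (zeroʳ β)))

            -- Starting the line at y - e instead of y moves its tangent point from parameter 0 to
            -- parameter 1, so `m` takes the value 1 at z. This excludes `m` = 0, which its
            -- vanishing at y does not.
            z : Carrierᴹ
            z = y +ᴹ (- 1#) *ₗ e

            tangent-z : ∀ {t} → Covered (z +ᴹ t *ₗ e) → t ≈ 1#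
            tangent-z {t} (a′ , μ , a′≉0 , eq) =
              trans (sym (+-identityˡ t)) (trans (+-congʳ (sym (-‿inverseʳ 1#))) (trans (+-assoc 1# (- 1#) t)
                (trans (+-congˡ (tangent { - 1# + t} (a′ , μ , a′≉0 , ≈ᴹ-trans eq (*ₗ-congˡ (shift ≈ᴹ-refl t)))))
                       (+-identityʳ 1#))))

            z+te≈y : ∀ {t} → t ≈ 1# → z +ᴹ t *ₗ e ≈ᴹ y
            z+te≈y {t} t≈1 = ≈ᴹ-trans (shift ≈ᴹ-refl t) (≈ᴹ-trans
              (+ᴹ-congˡ (≈ᴹ-trans (*ₗ-congʳ (trans (+-congˡ t≈1) (-‿inverseˡ 1#))) (*ₗ-zeroˡ e)))
              (+ᴹ-identityʳ y))

            mz≉0 : m.to z ≉ 0#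
            mz≉0 mz≈0 = 1≉0 (trans (sym mz≈1) mz≈0)
              where
              z-off = shift-off ≈ᴹ-refl y-off

              mz≈1 : m.to z ≈ 1#
              mz≈1 = trans (sym (m-moment z z-off)) (moment-tangent {S} {v} v-inc z-off 1#
                (λ P∈S → tangent-z (S⊆Covered P∈S))
                (λ t≈1 → Covered⊆S (a , β , a≉0 , ≈ᴹ-trans a≈βy (*ₗ-congˡ (≈ᴹ-sym (z+te≈y t≈1))))))

    -- Comparison of the linear set with the kernel of the functional.

    module _ {S : Pred Point 0ℓ} (S⊆Covered : ∀ {P} → P ∈ S → Covered (Point.coords P))
             (Covered⊆S : ∀ {P} → Covered (Point.coords P) → P ∈ S) where

      -- The inclusion of the kernel in `S` is a count: for x in the kernel, U and ⟨x⟩ both lie in a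
      -- space of size qⁿ⁺¹, while p^d q = p qⁿ⁺¹, so a nonzero vector of U is a multiple of x.
      kernel-hyperplane : ∀ (m : Functional) {z} → Functional.to m z ≉ 0# →
                          (∀ a → Functional.to m (embed a) ≈ 0#) → IsHyperplane S
      kernel-hyperplane m {z} mz≉0 m-embed≈0 =
        m.kernel , kernel-dimension m mz≉0 , (λ {P} → S⊆kernel {P}) , (λ {P} → kernel⊆S {P})
        where
        module m = Functional m
        open CoordinateFunctional {F = F} F# (suc n)

        j : Fin (suc (suc n))
        j = proj₁ (pivot m mz≉0)

        S⊆kernel : ∀ {P} → P ∈ S → m.to (Point.coords P) ≈ 0#
        S⊆kernel {P} P∈S = let (a , μ , a≉0 , eq) = S⊆Covered {P} P∈S in
          unscale-closed m.kernel (covered-scalar≉0 {x = Point.coords P} a≉0 eq)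
            (trans (m.cong (≈ᴹ-sym eq)) (m-embed≈0 a))

        kernel⊆S : ∀ {P} → m.to (Point.coords P) ≈ 0# → P ∈ S
        kernel⊆S {P} mP≈0 = Covered⊆S {P} (a , - 1# * c zero , a≉0 , ≈ᴹ-trans (u+v≈0⇒u≈-v sum≈0)
            (≈ᴹ-trans (*ₗ-congˡ (+ᴹ-identityʳ _)) (≈ᴹ-sym (*ₗ-assoc (- 1#) (c zero) x))))
          where
          x = Point.coords P

          #< : q ^ suc n < p ^ d ℕ.* q ^ 1
          #< rewrite pᵈ≡pqⁿ = ≡.subst (q ^ suc n <_)
            (solve 3 (λ p q Q → q :* Q :* p := p :* Q :* (q :* con 1)) ≡.refl p q (q ^ n))
            (ℕ.m<m*n (q ^ suc n) p ⦃ ℕ.m^n≢0 q (suc n) ⦄ 1<p)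

          dependence = mixed-dependence (x ∷ []) (punchIn j) #<
          a = proj₁ dependence
          c = proj₁ (proj₂ dependence)

          sum≈0 : embed a +ᴹ linearCombination c (x ∷ []) ≈ᴹ 0ᴹ
          sum≈0 = kernel-determined m mz≉0
            (Subspace.+-closed m.kernel {embed a} {linearCombination c (x ∷ [])} (m-embed≈0 a)
              (linearCombination-closed m.kernel c (x ∷ []) λ { zero → mP≈0 }))
            (proj₂ (proj₂ (proj₂ dependence)))

          a≉0 : ¬ a Kᵈ.≈ᴹ Kᵈ.0ᴹ
          a≉0 a≈0 = proj₁ (proj₂ (proj₂ dependence)) (a≈0 , λ { zero → *ₗ≈0⇒≈0 (Point.nonzero P)
            (≈ᴹ-trans (≈ᴹ-sym (≈ᴹ-trans
              (+ᴹ-cong (≈ᴹ-trans (embed-cong a≈0) embed-0) (+ᴹ-identityʳ _)) (+ᴹ-identityˡ _))) sum≈0) })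

      -- For each uncovered e, every line through e is shown to meet 𝓑(U₀) by refuting a missed one,
      -- which suffices since `MeetsKernel` is decidable; `some-plane-missed` then gives the
      -- contradiction. Hence every point is covered, which is impossible.
      codeword⇒hyperplane : Fin d → ¬ IsHyperplane S → ∀ {v} → v IsIncidenceVectorOf S → v ∉ C
      codeword⇒hyperplane i₀ ¬hyperplane {v} v-inc v∈C = not-all-covered λ e e≉0 → covered-at e e≉0
        where
        module At {e} (e≉0 : ¬ e ≈ᴹ 0ᴹ) (e-uncovered : ¬ Covered e) where
          open Moment K F F# 2<q ι-hom n e
          open Centre e≉0 e-uncovered

          m : Functional
          m = proj₁ (codeword-moment {v} v∈C)

          module m = Functional m

          m-moment : ∀ x x-off → moment v x x-off ≈ m.to x
          m-moment = proj₂ (codeword-moment {v} v∈C)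

          pullback : Kᵈ.Subspace 0ℓ
          pullback = record
            { Member    = λ a → m.to (embed a) ≈ 0#
            ; resp      = λ a≈a′ eq → trans (m.cong (embed-cong (Kᵈ.≈ᴹ-sym a≈a′))) eq
            ; 0-closed  = trans (m.cong embed-0) m.0-homo
            ; +-closed  = λ {a} {a′} eq eq′ → trans (m.cong (embed-+ a a′))
                (trans (m.+-homo _ _) (trans (+-cong eq eq′) (+-identityˡ 0#)))
            ; *ₗ-closed = λ s {a} eq → trans (m.cong (embed-* s a))
                (trans (m.*-homo _ _) (trans (*-congˡ eq) (zeroʳ _)))
            }

          pullback? : ∀ a → Dec (m.to (embed a) ≈ 0#)
          pullback? a = m.to (embed a) ≟ 0#

          impossible : ⊥
          impossible with Kᵈ.searchᴹ
            (λ a≈a′ ≉0 eq → ≉0 (trans (m.cong (embed-cong a≈a′)) eq)) (λ a → ¬? (pullback? a))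
          -- U is not inside the kernel of `m`. The vector a on a missed line has image in that
          -- kernel, where ψ vanishes by choice, yet ψ(a) ≠ 0 because the line misses the kernel of
          -- ψ.
          ... | yes (a* , a*∉) = let
              (ψ , ψ-pullback , ψa*≉0) = separatingFunctional {F = K} K# (coordinateModule K.ring d)
                (K.coordinates# d) pullback pullback? a*∉
            in some-plane-missed ψ ψa*≉0 λ x x-off →
              decidable-stable (meetsKernel? ψ ψa*≉0 x) λ missed →
                let open Tangent ψ ψa*≉0 x-off missed in
                ψa≉0 (ψ-pullback (embed-a∈kernel {S} S⊆Covered Covered⊆S {v} v-inc m m-moment))
          -- Here U lies in the kernel of `m`, and a missed line serves to show `m` ≠ 0. Any nonzero
          -- ψ will do: it is taken nonzero at the all-ones vector, which `i₀` keeps from being the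
          -- empty vector.
          ... | no ∄ = let
              (ψ , _ , ψ1≉0) = separatingFunctional {F = K} K# (coordinateModule K.ring d)
                (K.coordinates# d) Kᵈ.zeroSubspace (Kᵈ._≟ᴹ Kᵈ.0ᴹ) {λ _ → K.1#} (λ 1≈0 → K.1≉0 (1≈0 i₀))
            in some-plane-missed ψ ψ1≉0 λ x x-off →
              decidable-stable (meetsKernel? ψ ψ1≉0 x) λ missed →
                let open Tangent ψ ψ1≉0 x-off missed in
                ¬hyperplane (kernel-hyperplane m (mz≉0 {S} S⊆Covered Covered⊆S {v} v-inc m m-moment)
                  (λ a → decidable-stable (pullback? a) (λ ≉0 → ∄ (a , ≉0))))

        covered-at : ∀ e → ¬ e ≈ᴹ 0ᴹ → Covered e
        covered-at e e≉0 = decidable-stable (covered? e) (At.impossible e≉0)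

theorem4 :
    (p h n : ℕ) → Prime p → 1 < h → 2 ≤ n →
    (𝔽p 𝔽q : Field 0ℓ 0ℓ) → HasOrder 𝔽p p → HasOrder 𝔽q (p ^ h) →
    (ι : Field.Carrier 𝔽p → Field.Carrier 𝔽q) →
    (ι-hom : IsRingHomomorphism (Field.rawRing 𝔽p) (Field.rawRing 𝔽q) ι) →
    let open ProjectiveSpace 𝔽q n
        open HyperplaneCode 𝔽p 𝔽q n
        open FieldReduction 𝔽p 𝔽q ι-hom n
    in (S : Pred Point 0ℓ) → IsSmallLinearBlockingSet h S → ¬ IsHyperplane S →
       (v : Word) → v IsIncidenceVectorOf S → v ∉ C
theorem4 p h (suc n) _ 1<h _ 𝔽p 𝔽q 𝔽p# 𝔽q# ι ι-hom S (U , (b , basis) , S⊆𝓑U , 𝓑U⊆S) ¬hyperplane v v-inc =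
  codeword⇒hyperplane b independent {S}
    (λ {P} → S⊆Covered {P}) (λ {P} → Covered⊆S {P}) zero ¬hyperplane {v} v-inc
  where
  p<q : p < p ^ h
  p<q = ≡.subst (_< p ^ h) (ℕ.^-identityʳ p) (ℕ.^-monoʳ-< p (FiniteField.1<q {F = 𝔽p} 𝔽p#) 1<h)

  open FieldReduction 𝔽p 𝔽q ι-hom (suc n) using (Vᴷ)
  open ProjectiveSpace 𝔽q (suc n) using (Point)
  open LeftModule Vᴷ
  open LinearAlgebra Vᴷ using (module Subspace; module IsBasis)
  open Subspace U
  open IsBasis basis
  -- After matching on `suc n`, the vector space dimension of U is hn + 1, and p^(hn+1) = p (p^h)^n
  -- is the only form in which h is passed on, apart from p < q.
  open LinearSet 𝔽p 𝔽q 𝔽p# 𝔽q# p<q ι-hom n (suc (h ℕ.* n))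
    (≡.cong (p ℕ.*_) (≡.sym (ℕ.^-*-assoc p h n)))

  S⊆Covered : ∀ {P} → P ∈ S → Covered b independent (Point.coords P)
  S⊆Covered P∈S = let
      (w , w≉0 , (μ , w≈μP) , w∈U) = S⊆𝓑U P∈S
      (a , w≈ab) = spanning w∈U
    in a , μ
     , (λ a≈0 → w≉0 (≈ᴹ-trans w≈ab (≈ᴹ-trans (embed-cong b independent a≈0) (embed-0 b independent))))
     , ≈ᴹ-trans (≈ᴹ-sym w≈ab) w≈μP

  Covered⊆S : ∀ {P} → Covered b independent (Point.coords P) → P ∈ S
  Covered⊆S (a , μ , a≉0 , ab≈μP) = 𝓑U⊆S
    (embed b independent a , embed-nonzero b independent a≉0 , (μ , ab≈μP)
    , FieldModule.linearCombination-closed {F = 𝔽p} (Enumeration._≟_ 𝔽p#) Vᴷ U a b members)
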